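{- Let $G$ be a $k$-regular graph on $n$ vertices. If $n$ is odd and $k>2\lfloor n/5\rfloor$, then $G$ contains at least $\frac{1}{300}n^2$ triangles.
   Context: Graphs are finite and simple; a triangle is a copy of $K_3$ as a subgraph. -}

module Defs where

open import Data.Nat using (ℕ; _+_; _*_; _<ᵇ_)
open import Data.Bool using (Bool; true; false; if_then_else_; _∧_)
open import Data.Fin using (Fin; toℕ)
open import Data.List using (List; map; allFin)
open import Data.Nat.ListAction using (sum)
open import Relation.Binary.PropositionalEquality using (_≡_)

record Graph (n : ℕ) : Set where
  field
    adj    : Fin n → Fin n → Bool
    sym    : ∀ u v → adj u v ≡ adj v u
    irrefl : ∀ v → adj v v ≡ false
open Graph public

[_] : Bool → ℕ
[ b ] = if b then 1 else 0

Σv : ∀ {n} → (Fin n → ℕ) → ℕ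
Σv {n} f = sum (map f (allFin n))

degree : ∀ {n} → Graph n → Fin n → ℕ
degree G v = Σv (λ w → [ adj G v w ])

Regular : ∀ {n} → ℕ → Graph n → Set
Regular k G = ∀ v → degree G v ≡ k

triangles : ∀ {n} → Graph n → ℕ
triangles G =
  Σv (λ u → Σv (λ v → Σv (λ w →
    [ (toℕ u <ᵇ toℕ v) ∧ (toℕ v <ᵇ toℕ w)
      ∧ adj G u v ∧ adj G v w ∧ adj G u w ])))

{-# OPTIONS --safe #-}
module Submission where

-- Write T for the number of ordered triangles, codeg x y = |N(x) ∩ N(y)|, and h = 3k − n.
-- As n is odd, k is even, so 5k ≥ 2n + 2.  Suppose 50 T < n².
--
-- Averaging over the edges gives vertices u, v with disjoint neighbourhoods, both on very few
-- triangles.  Three neighbourhoods of size k in n points overlap, so for all x, y, c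
--     codeg x y + codeg x c + codeg y c ≥ h.                                              (*)
-- Case 1: every x has codeg x u ≤ 3h/8 or codeg x v ≤ 3h/8.  This splits the vertices into two
-- classes, of different sizes since n is odd.  By regularity the larger class spans at least k
-- ordered edges, and by (*) each of them has codegree at least h/4; hence 4T ≥ hk, too many.
-- Case 2: some x has p = codeg x u > 3h/8 and q = codeg x v > 3h/8.  By (*), the number of
-- triangles at any w is at least codeg w c · (h − codeg w c) up to a small error (c = u, v), so
-- p and q are in fact close to h, and there are few edges between P = N(x) ∩ N(u) and
-- Q = N(x) ∩ N(v).  Vertices of P and Q then have most of their remaining neighbours outside
-- N(u) ∪ N(v), so many w there see both P and Q (G resembles a blow-up of the 5-cycle), and
-- each such w lies on at least about 2h ordered triangles: again too many.

open import Defs hiding (sym)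
open import Data.Bool using (Bool; true; false; not; _∧_)
open import Data.Bool.Properties using (∧-comm) renaming (_≟_ to _≟ᵇ_)
open import Data.Fin using (Fin; toℕ) renaming (_≟_ to _≟ᶠ_)
open import Data.Fin.Properties using (any?; toℕ-injective)
open import Data.List using (List; []; _∷_; map; allFin; length)
open import Data.List.Properties using (length-tabulate)
open import Data.List.Membership.Propositional using (_∈_)
open import Data.List.Membership.Propositional.Properties using (∈-allFin)
open import Data.List.Relation.Unary.Any using (here; there)
open import Data.Nat
open import Data.Nat.Divisibility using (_∣_; divides; ∣m+n∣m⇒∣n; m∣m*n)
open import Data.Nat.DivMod using (m≡m%n+[m/n]*n; m%n<n; m*n%n≡0)
open import Data.Nat.ListAction using (sum)
open import Data.Nat.Properties
open import Data.Nat.Tactic.RingSolver using (solve-∀)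
open import Data.Product using (∃₂; _,_; proj₁; proj₂)
open import Function using (id; _∘_)
open import Relation.Binary using (tri<; tri≈; tri>)
open import Relation.Binary.PropositionalEquality hiding ([_]; J)
open import Relation.Nullary using (Dec; does; yes; no; ¬_; contradiction)
open import Relation.Nullary.Decidable using (toWitness; map′; _×-dec_; _→-dec_)
open ≤-Reasoning

-- Boolean comparison of natural numbers

flip-<ᵇ : ∀ a b → a ≢ b → (b <ᵇ a) ≡ not (a <ᵇ b)
flip-<ᵇ zero    zero    a≢b = contradiction refl a≢b
flip-<ᵇ zero    (suc b) a≢b = refl
flip-<ᵇ (suc a) zero    a≢b = refl
flip-<ᵇ (suc a) (suc b) a≢b = flip-<ᵇ a b (a≢b ∘ cong suc)

-- Transitivity as a Boolean equation, the form in which `order-bits` takes it as a hypothesis.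
<ᵇ-trans : ∀ a b c → (a <ᵇ b) ∧ (b <ᵇ c) ∧ not (a <ᵇ c) ≡ false
<ᵇ-trans zero    zero    c       = refl
<ᵇ-trans zero    (suc b) zero    = refl
<ᵇ-trans zero    (suc b) (suc c) with b <ᵇ c
... | true  = refl
... | false = refl
<ᵇ-trans (suc a) zero    c       = refl
<ᵇ-trans (suc a) (suc b) zero    with a <ᵇ b
... | true  = refl
... | false = refl
<ᵇ-trans (suc a) (suc b) (suc c) = <ᵇ-trans a b c

-- Finite sums

module _ {a} {A : Set a} where

  sum-map-cong : ∀ {f g : A → ℕ} xs → (∀ x → f x ≡ g x) → sum (map f xs) ≡ sum (map g xs)
  sum-map-cong []       f≗g = refl
  sum-map-cong (x ∷ xs) f≗g = cong₂ _+_ (f≗g x) (sum-map-cong xs f≗g)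

  sum-map-mono : ∀ {f g : A → ℕ} xs → (∀ x → f x ≤ g x) → sum (map f xs) ≤ sum (map g xs)
  sum-map-mono []       f≤g = z≤n
  sum-map-mono (x ∷ xs) f≤g = +-mono-≤ (f≤g x) (sum-map-mono xs f≤g)

  sum-map-+ : ∀ (f g : A → ℕ) xs →
              sum (map (λ x → f x + g x) xs) ≡ sum (map f xs) + sum (map g xs)
  sum-map-+ f g []       = refl
  sum-map-+ f g (x ∷ xs) = trans (cong (f x + g x +_) (sum-map-+ f g xs)) (interchange (f x) (g x) _ _)
    where
    interchange : ∀ a b c d → a + b + (c + d) ≡ a + c + (b + d)
    interchange = solve-∀

  sum-map-*ˡ : ∀ c (f : A → ℕ) xs → sum (map (λ x → c * f x) xs) ≡ c * sum (map f xs)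
  sum-map-*ˡ c f []       = sym (*-zeroʳ c)
  sum-map-*ˡ c f (x ∷ xs) = trans (cong (c * f x +_) (sum-map-*ˡ c f xs)) (sym (*-distribˡ-+ c (f x) _))

  sum-map-const : ∀ c (xs : List A) → sum (map (λ _ → c) xs) ≡ length xs * c
  sum-map-const c []       = refl
  sum-map-const c (_ ∷ xs) = cong (c +_) (sum-map-const c xs)

  sum-map-∈ : ∀ (f : A → ℕ) {x xs} → x ∈ xs → f x ≤ sum (map f xs)
  sum-map-∈ f (here refl) = m≤m+n (f _) _
  sum-map-∈ f (there x∈)  = ≤-trans (sum-map-∈ f x∈) (m≤n+m _ _)

sum-map-swap : ∀ {a b} {A : Set a} {B : Set b} (f : A → B → ℕ) xs ys →
               sum (map (λ x → sum (map (f x) ys)) xs) ≡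
               sum (map (λ y → sum (map (λ x → f x y) xs)) ys)
sum-map-swap f []       ys = sym (trans (sum-map-const 0 ys) (*-zeroʳ (length ys)))
sum-map-swap f (x ∷ xs) ys =
  trans (cong (sum (map (f x) ys) +_) (sum-map-swap f xs ys)) (sym (sum-map-+ (f x) _ ys))

module FinSum (n : ℕ) where

  Σ-cong : ∀ {f g : Fin n → ℕ} → (∀ x → f x ≡ g x) → Σv f ≡ Σv g
  Σ-cong = sum-map-cong (allFin n)

  Σ-mono : ∀ {f g : Fin n → ℕ} → (∀ x → f x ≤ g x) → Σv f ≤ Σv g
  Σ-mono = sum-map-mono (allFin n)

  Σ-+ : ∀ (f g : Fin n → ℕ) → Σv (λ x → f x + g x) ≡ Σv f + Σv g
  Σ-+ f g = sum-map-+ f g (allFin n)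

  Σ-*ˡ : ∀ c (f : Fin n → ℕ) → Σv (λ x → c * f x) ≡ c * Σv f
  Σ-*ˡ c f = sum-map-*ˡ c f (allFin n)

  Σ-*ʳ : ∀ c (f : Fin n → ℕ) → Σv (λ x → f x * c) ≡ Σv f * c
  Σ-*ʳ c f = trans (Σ-cong λ x → *-comm (f x) c) (trans (Σ-*ˡ c f) (*-comm c (Σv f)))

  Σ-const : ∀ c → Σv {n} (λ _ → c) ≡ n * c
  Σ-const c = trans (sum-map-const c (allFin n)) (cong (_* c) (length-tabulate {n = n} id))

  Σ-swap : ∀ (f : Fin n → Fin n → ℕ) → Σv (λ x → Σv (f x)) ≡ Σv (λ y → Σv (λ x → f x y))
  Σ-swap f = sum-map-swap f (allFin n) (allFin n)

  term≤Σ : ∀ (f : Fin n → ℕ) x → f x ≤ Σv f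
  term≤Σ f x = sum-map-∈ f (∈-allFin x)

  Σ-rotate : ∀ (f : Fin n → Fin n → Fin n → ℕ) →
             Σv (λ x → Σv λ y → Σv λ z → f y z x) ≡ Σv (λ x → Σv λ y → Σv λ z → f x y z)
  Σ-rotate f = trans (Σ-swap λ x y → Σv λ z → f y z x)
                     (Σ-cong λ y → Σ-swap λ x z → f y z x)

  Σ-swap₁₂ : ∀ (f : Fin n → Fin n → Fin n → ℕ) →
             Σv (λ x → Σv λ y → Σv λ z → f y x z) ≡ Σv (λ x → Σv λ y → Σv λ z → f x y z)
  Σ-swap₁₂ f = Σ-swap λ x y → Σv λ z → f y x z

  Σ³-mono : ∀ {f g : Fin n → Fin n → Fin n → ℕ} → (∀ x y z → f x y z ≤ g x y z) →
             Σv (λ x → Σv λ y → Σv λ z → f x y z) ≤ Σv (λ x → Σv λ y → Σv λ z → g x y z)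
  Σ³-mono f≤g = Σ-mono λ x → Σ-mono λ y → Σ-mono λ z → f≤g x y z

  Σ³-+ : ∀ (f g : Fin n → Fin n → Fin n → ℕ) →
         Σv (λ x → Σv λ y → Σv λ z → f x y z + g x y z) ≡
         Σv (λ x → Σv λ y → Σv λ z → f x y z) + Σv (λ x → Σv λ y → Σv λ z → g x y z)
  Σ³-+ f g = trans (Σ-cong λ x → trans (Σ-cong λ y → Σ-+ (f x y) (g x y)) (Σ-+ _ _)) (Σ-+ _ _)

  Σ²-+ : ∀ (f g : Fin n → Fin n → ℕ) →
         Σv (λ x → Σv λ y → f x y + g x y) ≡ Σv (λ x → Σv λ y → f x y) + Σv (λ x → Σv λ y → g x y)
  Σ²-+ f g = trans (Σ-cong λ x → Σ-+ (f x) (g x)) (Σ-+ _ _)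

  Σ²-*ˡ : ∀ c (f : Fin n → Fin n → ℕ) → Σv (λ x → Σv λ y → c * f x y) ≡ c * Σv (λ x → Σv λ y → f x y)
  Σ²-*ˡ c f = trans (Σ-cong λ x → Σ-*ˡ c (f x)) (Σ-*ˡ c _)

  -- Handshake lemma: off the diagonal every pair is increasing in exactly one of its two orders,
  -- and symmetry gives both orders the same weight.
  Σ-symmetric-even : ∀ (f : Fin n → Fin n → ℕ) → (∀ x y → f x y ≡ f y x) → (∀ x → f x x ≡ 0) →
                     2 ∣ Σv (λ x → Σv (f x))
  Σ-symmetric-even f f-sym f-diag = divides m (begin-equality
    Σv (λ x → Σv (f x))                          ≡⟨ Σ-cong (λ x → Σ-cong (pointwise x)) ⟩
    Σv (λ x → Σv λ y → g x y + g y x)            ≡⟨ Σ²-+ g (λ x y → g y x) ⟩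
    m + Σv (λ x → Σv λ y → g y x)                ≡⟨ cong (m +_) (Σ-swap (λ x y → g y x)) ⟩
    m + m                                        ≡⟨ e m ⟩
    m * 2                                        ∎)
    where
    g : Fin n → Fin n → ℕ
    g x y = [ toℕ x <ᵇ toℕ y ] * f x y
    m = Σv (λ x → Σv (g x))
    e : ∀ m → m + m ≡ m * 2
    e = solve-∀
    split : ∀ b c → c ≡ [ b ] * c + [ not b ] * c
    split true  c = e′ c
      where
      e′ : ∀ c → c ≡ 1 * c + 0
      e′ = solve-∀
    split false c = sym (*-identityˡ c)
    pointwise : ∀ x y → f x y ≡ g x y + g y x
    pointwise x y with x ≟ᶠ y
    ... | yes refl rewrite f-diag x = sym (cong₂ _+_ z z)
      where z = *-zeroʳ [ toℕ x <ᵇ toℕ x ]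
    ... | no x≢y rewrite flip-<ᵇ (toℕ x) (toℕ y) (x≢y ∘ toℕ-injective) | f-sym y x =
      split (toℕ x <ᵇ toℕ y) (f x y)

-- Indicators

-- Quantifiers over Booleans are decidable, so the pointwise inequalities below hold by evaluating
-- all cases.
∀ᵇ? : ∀ {p} {P : Bool → Set p} → (∀ b → Dec (P b)) → Dec (∀ b → P b)
∀ᵇ? P? = map′ (λ { (t , f) true → t ; (t , f) false → f }) (λ p → p true , p false)
              (P? true ×-dec P? false)

three-bits : ∀ x y c → [ x ] + [ y ] + [ c ] ≤
             1 + ([ x ] * [ y ] * [ not c ] + [ y ] * [ c ] + [ x ] * [ c ])
three-bits = toWitness {a? = ∀ᵇ? λ x → ∀ᵇ? λ y → ∀ᵇ? λ c → _ ≤? _} _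

-- Each summand asks its second vertex to lie in one of two disjoint sets, while the next rotation
-- asks the same vertex to lie outside both; so at most one rotation contributes. By disjointness it
-- contributes at most 1.
rotation-bits : ∀ a₁ b₁ a₂ b₂ a₃ b₃ → a₁ ∧ b₁ ≡ false → a₂ ∧ b₂ ≡ false → a₃ ∧ b₃ ≡ false →
  [ not a₁ ] * [ not b₁ ] * ([ a₂ ] * [ not a₃ ] + [ b₂ ] * [ not b₃ ]) +
  [ not a₂ ] * [ not b₂ ] * ([ a₃ ] * [ not a₁ ] + [ b₃ ] * [ not b₁ ]) +
  [ not a₃ ] * [ not b₃ ] * ([ a₁ ] * [ not a₂ ] + [ b₁ ] * [ not b₂ ]) ≤ 1
rotation-bits = toWitness
  {a? = ∀ᵇ? λ a₁ → ∀ᵇ? λ b₁ → ∀ᵇ? λ a₂ → ∀ᵇ? λ b₂ → ∀ᵇ? λ a₃ → ∀ᵇ? λ b₃ →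
   a₁ ∧ b₁ ≟ᵇ false →-dec (a₂ ∧ b₂ ≟ᵇ false →-dec (a₃ ∧ b₃ ≟ᵇ false →-dec _ ≤? _))} _

bit≤1 : ∀ b → [ b ] ≤ 1
bit≤1 true  = ≤-refl
bit≤1 false = z≤n

[]-∧ : ∀ a b → [ a ] * [ b ] ≡ 0 → a ∧ b ≡ false
[]-∧ true  false _ = refl
[]-∧ false _     _ = refl

split-bits : ∀ a b → a ∧ b ≡ false → [ not a ] * [ not b ] + ([ a ] + [ b ]) ≡ 1
split-bits = toWitness {a? = ∀ᵇ? λ a → ∀ᵇ? λ b → a ∧ b ≟ᵇ false →-dec _ ≟ _} _

-- Here l, m, s stand for x < y, y < z, x < z. The hypotheses exclude the two cyclic outcomes, and
-- the six summands are the possible orders of x, y, z, with the adjacency bits of a triangle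
-- already `true`.
order-bits : ∀ l m s → l ∧ m ∧ not s ≡ false → not l ∧ not m ∧ s ≡ false →
  let e = λ b c → [ b ∧ c ∧ true ∧ true ∧ true ] in
  1 ≤ e l m + e s (not m) + e (not l) s + e m (not s) + e (not s) l + e (not m) (not l)
order-bits = toWitness {a? = ∀ᵇ? λ l → ∀ᵇ? λ m → ∀ᵇ? λ s →
  l ∧ m ∧ not s ≟ᵇ false →-dec (not l ∧ not m ∧ s ≟ᵇ false →-dec _ ≤? _)} _

hole-bits : ∀ y v x → [ y ] * [ v ] + [ x ] * [ v ] ≤ [ x ] * [ v ] * [ y ] + [ v ]
hole-bits = toWitness {a? = ∀ᵇ? λ _ → ∀ᵇ? λ _ → ∀ᵇ? λ _ → _ ≤? _} _

cover-bits : ∀ y u v → [ y ] ≤ [ not u ] * [ not v ] * [ y ] + [ y ] * [ u ] + [ y ] * [ v ]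
cover-bits = toWitness {a? = ∀ᵇ? λ _ → ∀ᵇ? λ _ → ∀ᵇ? λ _ → _ ≤? _} _

disjoint-bits : ∀ u v → u ∧ v ≡ false → [ v ] ≤ [ not u ]
disjoint-bits = toWitness {a? = ∀ᵇ? λ u → ∀ᵇ? λ v → u ∧ v ≟ᵇ false →-dec _ ≤? _} _

share-bits : ∀ x u v → u ∧ v ≡ false → [ x ] * [ u ] + [ x ] * [ v ] ≤ [ x ]
share-bits = toWitness {a? = ∀ᵇ? λ x → ∀ᵇ? λ u → ∀ᵇ? λ v → u ∧ v ≟ᵇ false →-dec _ ≤? _} _

-- Inequalities between natural numbers

-- For p strictly between 3h/8 and 5h/8 the product p(h - p) exceeds 15h²/64, which is more than
-- 5h²/24.
past-middle : ∀ h p → 3 * h < 8 * p → 24 * (p * (h ∸ p)) ≤ 5 * (h * h) → 5 * h ≤ 8 * p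
past-middle h p 3h<8p le with 5 * h ≤? 8 * p
... | yes q = q
... | no ¬q = contradiction le (<⇒≱ (*-cancelˡ-< 8 _ _ main))
  where
  8p<5h : 8 * p < 5 * h
  8p<5h = ≰⇒> ¬q
  p≤h : p ≤ h
  p≤h = *-cancelˡ-≤ 8 (≤-trans (<⇒≤ 8p<5h) (*-monoˡ-≤ h (≤ᵇ⇒≤ 5 8 _)))
  d = h ∸ p
  h≡ : p + d ≡ h
  h≡ = m+[n∸m]≡n p≤h
  3d<5p : 3 * d < 5 * p
  3d<5p = +-cancelˡ-< (3 * p) _ _ (begin-strict
    3 * p + 3 * d ≡⟨ *-distribˡ-+ 3 p d ⟨
    3 * (p + d)   ≡⟨ cong (3 *_) h≡ ⟩
    3 * h         <⟨ 3h<8p ⟩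
    8 * p         ≡⟨ *-distribʳ-+ p 3 5 ⟩
    3 * p + 5 * p ∎)
  3p<5d : 3 * p < 5 * d
  3p<5d = +-cancelˡ-< (5 * p) _ _ (begin-strict
    5 * p + 3 * p ≡⟨ *-distribʳ-+ p 5 3 ⟨
    8 * p         <⟨ 8p<5h ⟩
    5 * h         ≡⟨ cong (5 *_) h≡ ⟨
    5 * (p + d)   ≡⟨ *-distribˡ-+ 5 p d ⟩
    5 * p + 5 * d ∎)
  -- (5p − 3d)(5d − 3p) = 64pd − 15(p + d)², and both factors are positive.
  x = 5 * p ∸ 3 * d
  y = 5 * d ∸ 3 * p
  X = m+[n∸m]≡n (<⇒≤ 3d<5p)
  Y = m+[n∸m]≡n (<⇒≤ 3p<5d)
  0<x : 0 < x
  0<x = m<n⇒0<n∸m 3d<5p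
  0<y : 0 < y
  0<y = m<n⇒0<n∸m 3p<5d
  idn : ∀ p d x y → 3 * d + x ≡ 5 * p → 3 * p + y ≡ 5 * d →
        x * y + 15 * ((p + d) * (p + d)) ≡ 64 * (p * d)
  idn p d x y ex ey = +-cancelʳ-≡ (3 * d * (3 * p) + (3 * d * y + 3 * p * x)) _ _ (begin-equality
    x * y + 15 * ((p + d) * (p + d)) + (3 * d * (3 * p) + (3 * d * y + 3 * p * x))
      ≡⟨ i1 p d x y ⟩
    (3 * d + x) * (3 * p + y) + 15 * ((p + d) * (p + d)) 
      ≡⟨ cong (_+ 15 * ((p + d) * (p + d))) (cong₂ _*_ ex ey) ⟩
    5 * p * (5 * d) + 15 * ((p + d) * (p + d))
      ≡⟨ i2 p d ⟩
    46 * (p * d) + (3 * d * (5 * d) + 3 * p * (5 * p)) + 9 * (p * d)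
      ≡⟨ cong (λ ● → 46 * (p * d) + ● + 9 * (p * d)) (cong₂ (λ a b → 3 * d * a + 3 * p * b) ey ex) ⟨
    46 * (p * d) + (3 * d * (3 * p + y) + 3 * p * (3 * d + x)) + 9 * (p * d)
      ≡⟨ i3 p d x y ⟩
    64 * (p * d) + (3 * d * (3 * p) + (3 * d * y + 3 * p * x)) ∎)
    where
    i1 : ∀ p d x y → x * y + 15 * ((p + d) * (p + d)) + (3 * d * (3 * p) + (3 * d * y + 3 * p * x)) ≡
         (3 * d + x) * (3 * p + y) + 15 * ((p + d) * (p + d))
    i1 = solve-∀
    i2 : ∀ p d → 5 * p * (5 * d) + 15 * ((p + d) * (p + d)) ≡ 46 * (p * d) + (3 * d * (5 * d) + 3 * p * (5 * p)) + 9 * (p * d)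
    i2 = solve-∀
    i3 : ∀ p d x y → 46 * (p * d) + (3 * d * (3 * p + y) + 3 * p * (3 * d + x)) + 9 * (p * d) ≡
         64 * (p * d) + (3 * d * (3 * p) + (3 * d * y + 3 * p * x))
    i3 = solve-∀
  -- Three times the identity `idn`: 3 · 64 = 8 · 24, and 3 · 15 = 45 is above 8 · 5 = 40.
  main : 8 * (5 * (h * h)) < 8 * (24 * (p * d))
  main = begin-strict
    8 * (5 * (h * h))        ≡⟨ *-assoc 8 5 (h * h) ⟨
    40 * (h * h)             ≤⟨ *-monoˡ-≤ (h * h) (≤ᵇ⇒≤ 40 45 _) ⟩
    45 * (h * h)             <⟨ m<n+m (45 * (h * h)) (*-mono-≤ {1} {3} {1} (s≤s z≤n) (*-mono-≤ 0<x 0<y)) ⟩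
    3 * (x * y) + 45 * (h * h) ≡⟨ cong (λ ● → 3 * (x * y) + 45 * (● * ●)) h≡ ⟨
    3 * (x * y) + 45 * ((p + d) * (p + d)) ≡⟨ j (x * y) ((p + d) * (p + d)) ⟩
    3 * (x * y + 15 * ((p + d) * (p + d))) ≡⟨ cong (3 *_) (idn p d x y X Y) ⟩
    3 * (64 * (p * d))       ≡⟨ *-assoc 3 64 (p * d) ⟨
    192 * (p * d)            ≡⟨ *-assoc 8 24 (p * d) ⟩
    8 * (24 * (p * d))       ∎
    where
    j : ∀ a b → 3 * a + 45 * b ≡ 3 * (a + 15 * b)
    j = solve-∀

-- Since h ≥ 4τ + 1, the difference h² - 24τ is at least 16τ(τ - 1) + 1.
24τ≤h² : ∀ τ h → 4 * τ < h → 24 * τ ≤ h * h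
24τ≤h² zero    h lt = z≤n
24τ≤h² (suc τ) h lt = begin
  24 * suc τ                                       ≤⟨ m≤m+n _ (1 + 16 * (τ * suc τ)) ⟩
  24 * suc τ + (1 + 16 * (τ * suc τ))              ≡⟨ eq τ ⟩
  suc (4 * suc τ) * suc (4 * suc τ)                ≤⟨ *-mono-≤ lt lt ⟩
  h * h                                            ∎
  where
  eq : ∀ τ → 24 * (1 + τ) + (1 + 16 * (τ * (1 + τ))) ≡ (1 + 4 * (1 + τ)) * (1 + 4 * (1 + τ))
  eq = solve-∀

-- With p and q at least 5h/8, the bound on the products turns into (h - p) + (h - q) ≤ h/3.
large-sum : ∀ h p q .{{_ : NonZero h}} → 5 * h ≤ 8 * p → 5 * h ≤ 8 * q →
            24 * (p * (h ∸ p) + q * (h ∸ q)) ≤ 5 * (h * h) → 5 * h ≤ 3 * (p + q)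
large-sum h p q 5h≤8p 5h≤8q le = +-cancelʳ-≤ h _ _ (begin
  5 * h + h                                  ≡⟨ e₁ h ⟩
  3 * (h + h)                                ≤⟨ *-monoʳ-≤ 3 (+-mono-≤ (m≤n+m∸n h p) (m≤n+m∸n h q)) ⟩
  3 * (p + (h ∸ p) + (q + (h ∸ q)))          ≡⟨ e₂ p q (h ∸ p) (h ∸ q) ⟩
  3 * (p + q) + 3 * ((h ∸ p) + (h ∸ q))      ≤⟨ +-monoʳ-≤ (3 * (p + q)) gap ⟩
  3 * (p + q) + h                            ∎)
  where
  e₁ : ∀ h → 5 * h + h ≡ 3 * (h + h)
  e₁ = solve-∀
  e₂ : ∀ p q s t → 3 * (p + s + (q + t)) ≡ 3 * (p + q) + 3 * (s + t)
  e₂ = solve-∀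
  e₃ : ∀ h s t → h * (5 * (3 * (s + t))) ≡ 3 * (5 * h * s + 5 * h * t)
  e₃ = solve-∀
  e₄ : ∀ p q s t → 3 * (8 * p * s + 8 * q * t) ≡ 24 * (p * s + q * t)
  e₄ = solve-∀
  e₅ : ∀ h → 5 * (h * h) ≡ h * (5 * h)
  e₅ = solve-∀
  gap : 3 * ((h ∸ p) + (h ∸ q)) ≤ h
  gap = *-cancelˡ-≤ 5 (*-cancelˡ-≤ h (begin
    h * (5 * (3 * ((h ∸ p) + (h ∸ q))))            ≡⟨ e₃ h (h ∸ p) (h ∸ q) ⟩
    3 * (5 * h * (h ∸ p) + 5 * h * (h ∸ q))
      ≤⟨ *-monoʳ-≤ 3 (+-mono-≤ (*-monoˡ-≤ (h ∸ p) 5h≤8p) (*-monoˡ-≤ (h ∸ q) 5h≤8q)) ⟩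
    3 * (8 * p * (h ∸ p) + 8 * q * (h ∸ q))        ≡⟨ e₄ p q (h ∸ p) (h ∸ q) ⟩
    24 * (p * (h ∸ p) + q * (h ∸ q))               ≤⟨ le ⟩
    5 * (h * h)                                    ≡⟨ e₅ h ⟩
    h * (5 * h)                                    ∎))

-- Multiply pA by 5h ≤ 8q and qB by 5h ≤ 8p: both become multiples of pq, and the bound on A + B
-- applies.
small-defect : ∀ h p q A B .{{_ : NonZero h}} → 5 * h ≤ 8 * p → 5 * h ≤ 8 * q →
               24 * (A + B) ≤ 5 * (h * h) → 3 * (p * A + q * B) ≤ p * q * h
small-defect h p q A B 5h≤8p 5h≤8q le = *-cancelˡ-≤ 5 (*-cancelˡ-≤ h (begin
  h * (5 * (3 * (p * A + q * B)))            ≡⟨ e₁ h p q A B ⟩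
  3 * (5 * h * (p * A) + 5 * h * (q * B))
    ≤⟨ *-monoʳ-≤ 3 (+-mono-≤ (*-monoˡ-≤ (p * A) 5h≤8q) (*-monoˡ-≤ (q * B) 5h≤8p)) ⟩
  3 * (8 * q * (p * A) + 8 * p * (q * B))    ≡⟨ e₂ p q A B ⟩
  p * q * (24 * (A + B))                     ≤⟨ *-monoʳ-≤ (p * q) le ⟩
  p * q * (5 * (h * h))                      ≡⟨ e₃ (p * q) h ⟩
  h * (5 * (p * q * h))                      ∎))
  where
  e₁ : ∀ h p q A B → h * (5 * (3 * (p * A + q * B))) ≡ 3 * (5 * h * (p * A) + 5 * h * (q * B))
  e₁ = solve-∀
  e₂ : ∀ p q A B → 3 * (8 * q * (p * A) + 8 * p * (q * B)) ≡ p * q * (24 * (A + B))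
  e₂ = solve-∀
  e₃ : ∀ M h → M * (5 * (h * h)) ≡ h * (5 * (M * h))
  e₃ = solve-∀

-- A concave function on the interval from 2 to h - 2 is smallest at the ends, where a(h - a) equals
-- 2(h - 2).
concave : ∀ a h → 2 ≤ a → a + 2 ≤ h → 2 * (h ∸ 2) ≤ a * (h ∸ a)
concave a h 2≤a a+2≤h = subst₂ (λ a h → 2 * (h ∸ 2) ≤ a * (h ∸ a)) a≡ h≡ (begin
  2 * (2 + a′ + 2 + c ∸ 2)             ≡⟨ cong (2 *_) (trans (cong (_∸ 2) (f a′ c)) (m+n∸n≡m (2 + a′ + c) 2)) ⟩
  2 * (2 + a′ + c)                     ≤⟨ m≤m+n _ (a′ * c) ⟩
  2 * (2 + a′ + c) + a′ * c            ≡⟨ e a′ c ⟩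
  (2 + a′) * (2 + c)                   ≡⟨ cong ((2 + a′) *_) (trans (cong (_∸ (2 + a′)) (+-assoc (2 + a′) 2 c)) (m+n∸m≡n (2 + a′) (2 + c))) ⟨
  (2 + a′) * (2 + a′ + 2 + c ∸ (2 + a′)) ∎)
  where
  a′ = a ∸ 2
  c = h ∸ (a + 2)
  a≡ : 2 + a′ ≡ a
  a≡ = m+[n∸m]≡n 2≤a
  h≡ : 2 + a′ + 2 + c ≡ h
  h≡ = trans (cong (λ ● → ● + 2 + c) a≡) (m+[n∸m]≡n a+2≤h)
  e : ∀ a c → 2 * (2 + a + c) + a * c ≡ (2 + a) * (2 + c)
  e = solve-∀
  f : ∀ a c → 2 + a + 2 + c ≡ 2 + a + c + 2
  f = solve-∀

-- a + b ≤ 2h − 2 leaves no room for a and b to be both ≥ h − 1 except a = b = h − 1.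
two-sided : ∀ a b h → 2 ≤ a → 2 ≤ b → a + b + 2 ≤ 2 * h →
            2 * (h ∸ 2) ≤ a * (h ∸ a) + b * (h ∸ b)
two-sided a b h 2≤a 2≤b ab with a + 2 ≤? h | b + 2 ≤? h
... | yes a≤ | _      = ≤-trans (concave a h 2≤a a≤) (m≤m+n _ _)
... | no _   | yes b≤ = ≤-trans (concave b h 2≤b b≤) (m≤n+m _ _)
... | no a≰  | no b≰  = begin
  2 * (h ∸ 2)                   ≤⟨ *-monoʳ-≤ 2 (∸-monoʳ-≤ h (s≤s (z≤n {1}))) ⟩
  2 * (h ∸ 1)                   ≡⟨ cong (h ∸ 1 +_) (+-identityʳ (h ∸ 1)) ⟩
  h ∸ 1 + (h ∸ 1)               ≤⟨ +-mono-≤ (one a b a≰ b≰ ab) (one b a b≰ a≰ (subst (λ ● → ● + 2 ≤ 2 * h) (+-comm a b) ab)) ⟩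
  a * (h ∸ a) + b * (h ∸ b)     ∎
  where
  one : ∀ a b → ¬ a + 2 ≤ h → ¬ b + 2 ≤ h → a + b + 2 ≤ 2 * h → h ∸ 1 ≤ a * (h ∸ a)
  one a b a≰ b≰ ab = begin
    h ∸ 1          ≤⟨ ∸-monoˡ-≤ 1 (≤-pred (subst (h <_) (+-comm a 2) (≰⇒> a≰))) ⟩
    a              ≡⟨ *-identityʳ a ⟨
    a * 1          ≤⟨ *-monoʳ-≤ a (m<n⇒0<n∸m a<h) ⟩
    a * (h ∸ a)    ∎
    where
    a<h : a < h
    a<h = +-cancelʳ-≤ h _ _ (begin
      suc a + h          ≤⟨ +-monoʳ-≤ (suc a) (≤-pred (subst (h <_) (+-comm b 2) (≰⇒> b≰))) ⟩
      suc a + suc b      ≡⟨ e a b ⟩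
      a + b + 2          ≤⟨ ab ⟩
      2 * h              ≡⟨ cong (h +_) (+-identityʳ h) ⟩
      h + h              ∎)
      where
      e : ∀ a b → 1 + a + (1 + b) ≡ a + b + 2
      e = solve-∀

-- If a and b are at least 2, this is `two-sided` with ij ≤ pq. If one of them is 0, so is ij. If a
-- = 1, its product is only h - 1, about half of what is wanted, but then i ≤ 1 and p ≥ 2 make ij at
-- most pq/2; likewise for b = 1.
weighted-two-sided : ∀ a b h p q i j → 2 ≤ p → 2 ≤ q → a + b + 2 ≤ 2 * h →
  i ≤ a → i ≤ p → j ≤ b → j ≤ q →
  2 * (h ∸ 2) * (i * j) ≤ p * q * (a * (h ∸ a) + b * (h ∸ b))
weighted-two-sided zero b h p q .zero j _ _ _ z≤n _ _ _ = ≤-trans (≤-reflexive (*-zeroʳ (2 * (h ∸ 2)))) z≤n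
weighted-two-sided (suc a) zero h p q i .zero _ _ _ _ _ z≤n _ =
  ≤-trans (≤-reflexive (trans (cong (2 * (h ∸ 2) *_) (*-zeroʳ i)) (*-zeroʳ (2 * (h ∸ 2))))) z≤n
weighted-two-sided (suc zero) b@(suc _) h p q i j 2≤p _ _ i≤1 _ _ j≤q = begin
  2 * (h ∸ 2) * (i * j)     ≤⟨ *-monoʳ-≤ (2 * (h ∸ 2)) (*-mono-≤ i≤1 j≤q) ⟩
  2 * (h ∸ 2) * (1 * q)     ≡⟨ e (h ∸ 2) q ⟩
  2 * q * (h ∸ 2)           ≤⟨ *-mono-≤ (*-monoˡ-≤ q 2≤p) (∸-monoʳ-≤ h (s≤s (z≤n {1}))) ⟩
  p * q * (h ∸ 1)           ≡⟨ cong (p * q *_) (*-identityˡ (h ∸ 1)) ⟨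
  p * q * (1 * (h ∸ 1))     ≤⟨ *-monoʳ-≤ (p * q) (m≤m+n _ _) ⟩
  p * q * (1 * (h ∸ 1) + b * (h ∸ b)) ∎
  where
  e : ∀ x q → 2 * x * (1 * q) ≡ 2 * q * x
  e = solve-∀
weighted-two-sided a@(suc (suc _)) (suc zero) h p q i j _ 2≤q _ _ i≤p j≤1 _ = begin
  2 * (h ∸ 2) * (i * j)     ≤⟨ *-monoʳ-≤ (2 * (h ∸ 2)) (*-mono-≤ i≤p j≤1) ⟩
  2 * (h ∸ 2) * (p * 1)     ≡⟨ e (h ∸ 2) p ⟩
  p * 2 * (h ∸ 2)           ≤⟨ *-mono-≤ (*-monoʳ-≤ p 2≤q) (∸-monoʳ-≤ h (s≤s (z≤n {1}))) ⟩
  p * q * (h ∸ 1)           ≡⟨ cong (p * q *_) (*-identityˡ (h ∸ 1)) ⟨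
  p * q * (1 * (h ∸ 1))     ≤⟨ *-monoʳ-≤ (p * q) (m≤n+m (1 * (h ∸ 1)) (a * (h ∸ a))) ⟩
  p * q * (a * (h ∸ a) + 1 * (h ∸ 1)) ∎
  where
  e : ∀ x p → 2 * x * (p * 1) ≡ p * 2 * x
  e = solve-∀
weighted-two-sided a@(suc (suc _)) b@(suc (suc _)) h p q i j _ _ ab _ i≤p _ j≤q = begin
  2 * (h ∸ 2) * (i * j)                  ≡⟨ *-comm (2 * (h ∸ 2)) (i * j) ⟩
  i * j * (2 * (h ∸ 2))                  ≤⟨ *-mono-≤ (*-mono-≤ i≤p j≤q) (two-sided a b h (s≤s (s≤s z≤n)) (s≤s (s≤s z≤n)) ab) ⟩
  p * q * (a * (h ∸ a) + b * (h ∸ b))    ∎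

-- The arithmetic that ends Case 2. Π/(pq) is at least about h/3 and Γ is at least 2(h - 2) times
-- that, so 3Γ is at least about 2h²/3; more exactly 2(h - 2)(h + 6) bounds 3Γ from below, while T +
-- 3rτ is at most h²/2 + 3h(h - 2)/4.
no-dense-blowup : ∀ h r p q T τ A B Π Γ .{{_ : NonZero h}} → r + 2 ≤ h → p + q ≤ h + r →
  2 * T ≤ h * h → 4 * τ ≤ h →
  5 * h ≤ 8 * p → 5 * h ≤ 8 * q → 5 * h ≤ 3 * (p + q) → 24 * (A + B) ≤ 5 * (h * h) →
  p * q * (p + q) ≤ Π + r * (p * q) + (p * A + q * B) →
  2 * (h ∸ 2) * Π ≤ p * q * Γ →
  ¬ 3 * Γ ≤ T + 3 * (r * τ)
no-dense-blowup h r p q T τ A B Π Γ r+2≤h p+q≤k 2T≤ 4τ≤ 5h≤8p 5h≤8q 5h≤ small Π-lower Γ-lower Γ-upper =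
  <⇒≱ lower upper
  where
  d = h ∸ 2
  2≤h : 2 ≤ h
  2≤h = ≤-trans (m≤n+m 2 r) r+2≤h
  h≡ : d + 2 ≡ h
  h≡ = m∸n+n≡m 2≤h
  r≤d : r ≤ d
  r≤d = subst (_≤ d) (m+n∸n≡m r 2) (∸-monoˡ-≤ 2 r+2≤h)
  -- The sum p + q lies between 5h/3 and h + r ≤ 2h - 2.
  6≤h : 6 ≤ h
  6≤h = +-cancelˡ-≤ (5 * h) _ _ (begin
    5 * h + 6               ≤⟨ +-monoˡ-≤ 6 (≤-trans 5h≤ (*-monoʳ-≤ 3 p+q≤k)) ⟩
    3 * (h + r) + 6         ≡⟨ e h r ⟩
    3 * h + 3 * (r + 2)     ≤⟨ +-monoʳ-≤ (3 * h) (*-monoʳ-≤ 3 r+2≤h) ⟩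
    3 * h + 3 * h           ≡⟨ e′ h ⟩
    5 * h + h               ∎)
    where
    e : ∀ h r → 3 * (h + r) + 6 ≡ 3 * h + 3 * (r + 2)
    e = solve-∀
    e′ : ∀ h → 3 * h + 3 * h ≡ 5 * h + h
    e′ = solve-∀
  positive : ∀ p → 5 * h ≤ 8 * p → NonZero p
  positive zero le = contradiction (≤-trans (*-monoʳ-≤ 5 (≤-trans (s≤s z≤n) 6≤h)) le) λ ()
  positive (suc p) _ = _
  instance
    pq≢0 : NonZero (p * q)
    pq≢0 = m*n≢0 p q {{positive p 5h≤8p}} {{positive q 5h≤8q}}
  M = p * q
  -- Divided by M, `Π-lower` reads Π/M ≥ 5h/3 - r - h/3, and r ≤ h - 2 leaves h/3 + 2.
  Π-bound : M * (h + 6) ≤ 3 * Π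
  Π-bound = +-cancelʳ-≤ (3 * (r * M) + M * h) _ _ (begin
    M * (h + 6) + (3 * (r * M) + M * h)   ≡⟨ e₁ M h r ⟩
    M * (3 * (r + 2) + 2 * h)             ≤⟨ *-monoʳ-≤ M (+-monoˡ-≤ (2 * h) (*-monoʳ-≤ 3 r+2≤h)) ⟩
    M * (3 * h + 2 * h)                   ≡⟨ cong (M *_) (*-distribʳ-+ h 3 2) ⟨
    M * (5 * h)                           ≤⟨ *-monoʳ-≤ M 5h≤ ⟩
    M * (3 * (p + q))                     ≡⟨ e₂ M (p + q) ⟩
    3 * (M * (p + q))                     ≤⟨ *-monoʳ-≤ 3 Π-lower ⟩
    3 * (Π + r * M + (p * A + q * B))     ≡⟨ e₃ Π (r * M) (p * A + q * B) ⟩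
    3 * Π + 3 * (r * M) + 3 * (p * A + q * B) ≤⟨ +-monoʳ-≤ (3 * Π + 3 * (r * M)) (small-defect h p q A B 5h≤8p 5h≤8q small) ⟩
    3 * Π + 3 * (r * M) + M * h           ≡⟨ +-assoc (3 * Π) _ _ ⟩
    3 * Π + (3 * (r * M) + M * h)         ∎)
    where
    e₁ : ∀ M h r → M * (h + 6) + (3 * (r * M) + M * h) ≡ M * (3 * (r + 2) + 2 * h)
    e₁ = solve-∀
    e₂ : ∀ M s → M * (3 * s) ≡ 3 * (M * s)
    e₂ = solve-∀
    e₃ : ∀ a b c → 3 * (a + b + c) ≡ 3 * a + 3 * b + 3 * c
    e₃ = solve-∀
  Γ-bound : 2 * d * (h + 6) ≤ 3 * Γ
  Γ-bound = *-cancelˡ-≤ M (begin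
    M * (2 * d * (h + 6))    ≡⟨ e₁ M (2 * d) (h + 6) ⟩
    2 * d * (M * (h + 6))    ≤⟨ *-monoʳ-≤ (2 * d) Π-bound ⟩
    2 * d * (3 * Π)          ≡⟨ e₁ (2 * d) 3 Π ⟩
    3 * (2 * d * Π)          ≤⟨ *-monoʳ-≤ 3 Γ-lower ⟩
    3 * (M * Γ)              ≡⟨ e₁ 3 M Γ ⟩
    M * (3 * Γ)              ∎)
    where
    e₁ : ∀ a b c → a * (b * c) ≡ b * (a * c)
    e₁ = solve-∀
  upper : 4 * (2 * d * (h + 6)) ≤ 2 * (h * h) + 3 * (d * h)
  upper = begin
    4 * (2 * d * (h + 6))           ≤⟨ *-monoʳ-≤ 4 (≤-trans Γ-bound Γ-upper) ⟩
    4 * (T + 3 * (r * τ))           ≡⟨ e₁ T r τ ⟩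
    2 * (2 * T) + 3 * (r * (4 * τ)) ≤⟨ +-mono-≤ (*-monoʳ-≤ 2 2T≤) (*-monoʳ-≤ 3 (*-mono-≤ r≤d 4τ≤)) ⟩
    2 * (h * h) + 3 * (d * h)       ∎
    where
    e₁ : ∀ T r τ → 4 * (T + 3 * (r * τ)) ≡ 2 * (2 * T) + 3 * (r * (4 * τ))
    e₁ = solve-∀
  -- In terms of d = h - 2 this compares 5d² + 14d + 8 with 8d² + 64d; the constant 8 is absorbed by
  -- 50d because d ≥ 1.
  lower : 2 * (h * h) + 3 * (d * h) < 4 * (2 * d * (h + 6))
  lower = subst (λ h → 2 * (h * h) + 3 * (d * h) < 4 * (2 * d * (h + 6))) h≡ (begin-strict
    2 * ((d + 2) * (d + 2)) + 3 * (d * (d + 2)) ≡⟨ e₁ d ⟩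
    5 * (d * d) + 14 * d + 8                    <⟨ +-monoʳ-< (5 * (d * d) + 14 * d) (≤-trans (≤ᵇ⇒≤ 9 50 _) (*-monoʳ-≤ 50 (≤-trans (s≤s z≤n) (∸-monoˡ-≤ 2 6≤h)))) ⟩
    5 * (d * d) + 14 * d + 50 * d               ≤⟨ m≤m+n _ (3 * (d * d)) ⟩
    5 * (d * d) + 14 * d + 50 * d + 3 * (d * d) ≡⟨ e₂ d ⟩
    4 * (2 * d * (d + 2 + 6))                   ∎)
    where
    e₁ : ∀ d → 2 * ((d + 2) * (d + 2)) + 3 * (d * (d + 2)) ≡ 5 * (d * d) + 14 * d + 8
    e₁ = solve-∀
    e₂ : ∀ d → 5 * (d * d) + 14 * d + 50 * d + 3 * (d * d) ≡ 4 * (2 * d * (d + 2 + 6))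
    e₂ = solve-∀

-- (p − i)(q − j) ≥ 0
cross≤ : ∀ {i j p q} → i ≤ p → j ≤ q → p * j + q * i ≤ i * j + p * q
cross≤ {i} {j} {p} {q} i≤p j≤q = subst₂ (λ p q → p * j + q * i ≤ i * j + p * q)
  (m+[n∸m]≡n i≤p) (m+[n∸m]≡n j≤q)
  (≤-trans (m≤m+n _ ((p ∸ i) * (q ∸ j))) (≤-reflexive (e i j (p ∸ i) (q ∸ j))))
  where
  e : ∀ i j a b → (i + a) * j + (j + b) * i + a * b ≡ i * j + (i + a) * (j + b)
  e = solve-∀

-- Triangles and codegrees

module Counting {n : ℕ} (G : Graph n) where
  open FinSum n

  α ᾱ : Fin n → Fin n → ℕ
  α x y = [ adj G x y ]
  ᾱ x y = [ not (adj G x y) ]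

  α-sym : ∀ x y → α x y ≡ α y x
  α-sym x y = cong [_] (Graph.sym G x y)

  codeg : Fin n → Fin n → ℕ
  codeg x y = Σv λ z → α x z * α y z

  codeg-sym : ∀ x y → codeg x y ≡ codeg y x
  codeg-sym x y = Σ-cong λ z → *-comm (α x z) (α y z)

  -- Tv x counts the ordered triangles with first vertex x, so T counts every triangle six times.
  Tv : Fin n → ℕ
  Tv x = Σv λ y → α x y * codeg x y

  T : ℕ
  T = Σv Tv

  t : Fin n → Fin n → Fin n → ℕ
  t x y z = α x y * (α x z * α y z)

  T≡Σ³t : T ≡ Σv λ x → Σv λ y → Σv λ z → t x y z
  T≡Σ³t = Σ-cong λ x → Σ-cong λ y → sym (Σ-*ˡ (α x y) _)

  private
    o : Fin n → Fin n → Fin n → ℕ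
    o x y z = [ (toℕ x <ᵇ toℕ y) ∧ (toℕ y <ᵇ toℕ z) ∧ adj G x y ∧ adj G y z ∧ adj G x z ]

    adj⇒≢ : ∀ {x y} → adj G x y ≡ true → toℕ x ≢ toℕ y
    adj⇒≢ {x} xy x≡y with toℕ-injective x≡y
    ... | refl = contradiction (trans (sym xy) (irrefl G x)) λ ()

    -- By irreflexivity the vertices of a triangle are distinct, so one of their six orders is
    -- increasing.
    t≤orders : ∀ x y z → t x y z ≤ o x y z + o x z y + o y x z + o y z x + o z x y + o z y x
    t≤orders x y z with adj G x y in xy | adj G x z in xz | adj G y z in yz
    ... | false | _     | _     = z≤n
    ... | true  | false | _     = z≤n
    ... | true  | true  | false = z≤n
    ... | true  | true  | true
      rewrite trans (Graph.sym G y x) xy | trans (Graph.sym G z x) xz | trans (Graph.sym G z y) yz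
            | flip-<ᵇ (toℕ x) (toℕ y) (adj⇒≢ xy) | flip-<ᵇ (toℕ x) (toℕ z) (adj⇒≢ xz)
            | flip-<ᵇ (toℕ y) (toℕ z) (adj⇒≢ yz) =
      order-bits (toℕ x <ᵇ toℕ y) (toℕ y <ᵇ toℕ z) (toℕ x <ᵇ toℕ z)
        (<ᵇ-trans (toℕ x) (toℕ y) (toℕ z)) reversed
      where
      -- Transitivity along z < y < x, with each comparison flipped.
      reversed : not (toℕ x <ᵇ toℕ y) ∧ not (toℕ y <ᵇ toℕ z) ∧ (toℕ x <ᵇ toℕ z) ≡ false
      reversed with toℕ x <ᵇ toℕ y in p | toℕ y <ᵇ toℕ z in q | toℕ x <ᵇ toℕ z in r
      ... | true  | _     | _     = refl
      ... | false | true  | _     = refl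
      ... | false | false | false = refl
      ... | false | false | true  = contradiction (<ᵇ-trans (toℕ z) (toℕ y) (toℕ x)) bad
        where
        bad : (toℕ z <ᵇ toℕ y) ∧ (toℕ y <ᵇ toℕ x) ∧ not (toℕ z <ᵇ toℕ x) ≢ false
        bad rewrite flip-<ᵇ (toℕ x) (toℕ y) (adj⇒≢ xy) | flip-<ᵇ (toℕ x) (toℕ z) (adj⇒≢ xz)
                  | flip-<ᵇ (toℕ y) (toℕ z) (adj⇒≢ yz) | p | q | r = λ ()

  -- Renaming the summation variables makes the six sums from `t≤orders` equal.
  T≤6triangles : T ≤ 6 * triangles G
  T≤6triangles = begin
    T                                            ≡⟨ T≡Σ³t ⟩
    Σ³ t                                         ≤⟨ Σ³-mono t≤orders ⟩
    Σ³ (λ x y z → o₁ x y z + o₂ x y z + o₃ x y z + o₄ x y z + o₅ x y z + o₆ x y z)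
      ≡⟨ Σ³-+ _ o₆ ⟩
    Σ³ (λ x y z → o₁ x y z + o₂ x y z + o₃ x y z + o₄ x y z + o₅ x y z) + Σ³ o₆
      ≡⟨ cong (_+ Σ³ o₆) (Σ³-+ _ o₅) ⟩
    Σ³ (λ x y z → o₁ x y z + o₂ x y z + o₃ x y z + o₄ x y z) + Σ³ o₅ + Σ³ o₆
      ≡⟨ cong (λ ● → ● + Σ³ o₅ + Σ³ o₆) (Σ³-+ _ o₄) ⟩
    Σ³ (λ x y z → o₁ x y z + o₂ x y z + o₃ x y z) + Σ³ o₄ + Σ³ o₅ + Σ³ o₆
      ≡⟨ cong (λ ● → ● + Σ³ o₄ + Σ³ o₅ + Σ³ o₆) (trans (Σ³-+ _ o₃) (cong (_+ Σ³ o₃) (Σ³-+ o₁ o₂))) ⟩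
    Σ³ o₁ + Σ³ o₂ + Σ³ o₃ + Σ³ o₄ + Σ³ o₅ + Σ³ o₆
      ≡⟨ cong₂ _+_ (cong₂ _+_ (cong₂ _+_ (cong₂ _+_ (cong (Σ³ o₁ +_) q₂) q₃) q₄) q₅) q₆ ⟩
    Σ³ o + Σ³ o + Σ³ o + Σ³ o + Σ³ o + Σ³ o      ≡⟨ e (Σ³ o) ⟩
    6 * Σ³ o                                     ∎
    where
    Σ³ : (Fin n → Fin n → Fin n → ℕ) → ℕ
    Σ³ f = Σv λ x → Σv λ y → Σv λ z → f x y z
    o₁ o₂ o₃ o₄ o₅ o₆ : Fin n → Fin n → Fin n → ℕ
    o₁ x y z = o x y z
    o₂ x y z = o x z y
    o₃ x y z = o y x z
    o₄ x y z = o y z x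
    o₅ x y z = o z x y
    o₆ x y z = o z y x
    q₂ : Σ³ o₂ ≡ Σ³ o
    q₂ = Σ-cong λ x → Σ-swap (o₂ x)
    q₃ : Σ³ o₃ ≡ Σ³ o
    q₃ = Σ-swap₁₂ o
    q₄ : Σ³ o₄ ≡ Σ³ o
    q₄ = Σ-rotate o
    q₅ : Σ³ o₅ ≡ Σ³ o
    q₅ = sym (Σ-rotate o₅)
    q₆ : Σ³ o₆ ≡ Σ³ o
    q₆ = trans (Σ-cong λ x → Σ-swap (o₆ x)) q₄
    e : ∀ m → m + m + m + m + m + m ≡ 6 * m
    e = solve-∀

  α-diag : ∀ x → α x x ≡ 0
  α-diag x = cong [_] (irrefl G x)

  module _ {k : ℕ} (reg : Regular k G) where

    Σα : Σv (λ x → Σv (α x)) ≡ n * k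
    Σα = trans (Σ-cong reg) (Σ-const k)

    nk-even : 2 ∣ n * k
    nk-even = subst (2 ∣_) Σα (Σ-symmetric-even α α-sym α-diag)

    -- If 50T < n², its average over the edges is below k, so that an edge of at most average weight has
    -- codegree 0.
    weight : Fin n → Fin n → ℕ
    weight x y = 2 * Tv x + 2 * Tv y + k * codeg x y

    Σα*Tv : Σv (λ x → Σv λ y → α x y * (2 * Tv x)) ≡ 2 * (k * T)
    Σα*Tv = begin-equality
      Σv (λ x → Σv λ y → α x y * (2 * Tv x))   ≡⟨ Σ-cong (λ x → trans (Σ-*ʳ (2 * Tv x) (α x)) (cong (_* (2 * Tv x)) (reg x))) ⟩
      Σv (λ x → k * (2 * Tv x))                ≡⟨ Σ-cong (λ x → e k (Tv x)) ⟩
      Σv (λ x → 2 * k * Tv x)                  ≡⟨ Σ-*ˡ (2 * k) Tv ⟩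
      2 * k * T                                ≡⟨ *-assoc 2 k T ⟩
      2 * (k * T)                              ∎
      where
      e : ∀ k a → k * (2 * a) ≡ 2 * k * a
      e = solve-∀

    -- Every vertex lies on k edges, so each of the two vertex terms sums to 2kT; the codegrees of
    -- the ordered edges sum to T by definition.
    Σα*weight : Σv (λ x → Σv λ y → α x y * weight x y) ≡ 5 * (k * T)
    Σα*weight = begin-equality
      Σv (λ x → Σv λ y → α x y * weight x y)
        ≡⟨ Σ-cong (λ x → Σ-cong λ y → pointwise x y) ⟩
      Σv (λ x → Σv λ y → f x y + f y x + k * (α x y * codeg x y))
        ≡⟨ trans (Σ²-+ (λ x y → f x y + f y x) _) (cong (_+ C) (Σ²-+ f (λ x y → f y x))) ⟩
      F + Σv (λ x → Σv λ y → f y x) + C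
        ≡⟨ cong₂ _+_ (cong₂ _+_ Σα*Tv (trans (Σ-swap (λ x y → f y x)) Σα*Tv)) (Σ²-*ˡ k _) ⟩
      2 * (k * T) + 2 * (k * T) + k * T
        ≡⟨ e (k * T) ⟩
      5 * (k * T) ∎
      where
      f : Fin n → Fin n → ℕ
      f x y = α x y * (2 * Tv x)
      F = Σv λ x → Σv λ y → f x y
      C = Σv λ x → Σv λ y → k * (α x y * codeg x y)
      e : ∀ m → 2 * m + 2 * m + m ≡ 5 * m
      e = solve-∀
      e′ : ∀ a b c k d → a * (b + c + k * d) ≡ a * b + a * c + k * (a * d)
      e′ = solve-∀
      pointwise : ∀ x y → α x y * weight x y ≡ f x y + f y x + k * (α x y * codeg x y)
      pointwise x y = trans (e′ (α x y) (2 * Tv x) (2 * Tv y) k (codeg x y))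
        (cong (λ ● → f x y + ● * (2 * Tv y) + k * (α x y * codeg x y)) (α-sym x y))

    -- Averaging over the nk ordered edges: if n times the weight were at least 5T + 1 on all of
    -- them, the total would exceed its actual value 5nkT by at least nk > 0.
    light-edge : 0 < n * k → ∃₂ λ u v → n * weight u v ≤ 5 * T
    light-edge nk>0 with any? (λ u → any? λ v → (adj G u v ≟ᵇ true) ×-dec (n * weight u v ≤? 5 * T))
    ... | yes (u , v , _ , le) = u , v , le
    ... | no ¬∃ = contradiction nk>0 (≤⇒≯ (+-cancelʳ-≤ (n * k * (5 * T)) _ _ (begin
      n * k + n * k * (5 * T)              ≡⟨ *-suc (n * k) (5 * T) ⟨
      n * k * suc (5 * T)                  ≡⟨ cong (_* suc (5 * T)) Σα ⟨
      Σv (λ x → Σv (α x)) * suc (5 * T)    ≡⟨ Σ-*ʳ (suc (5 * T)) _ ⟨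
      Σv (λ x → Σv (α x) * suc (5 * T))    ≡⟨ Σ-cong (λ x → Σ-*ʳ (suc (5 * T)) (α x)) ⟨
      Σv (λ x → Σv λ y → α x y * suc (5 * T))  ≤⟨ Σ-mono (λ x → Σ-mono λ y → pointwise x y) ⟩
      Σv (λ x → Σv λ y → n * (α x y * weight x y))  ≡⟨ Σ²-*ˡ n _ ⟩
      n * Σv (λ x → Σv λ y → α x y * weight x y)    ≡⟨ cong (n *_) Σα*weight ⟩
      n * (5 * (k * T))                    ≡⟨ e n k T ⟩
      n * k * (5 * T)                      ∎)))
      where
      e : ∀ n k T → n * (5 * (k * T)) ≡ n * k * (5 * T)
      e = solve-∀
      pointwise : ∀ x y → α x y * suc (5 * T) ≤ n * (α x y * weight x y)
      pointwise x y with adj G x y in xy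
      ... | false = z≤n
      ... | true  = begin
        1 * suc (5 * T)        ≡⟨ *-identityˡ _ ⟩
        suc (5 * T)            ≤⟨ ≰⇒> (λ le → ¬∃ (x , y , xy , le)) ⟩
        n * weight x y         ≡⟨ cong (n *_) (*-identityˡ (weight x y)) ⟨
        n * (1 * weight x y)   ∎

-- Overlaps of neighbourhoods in a regular graph

module Structure {n k : ℕ} (G : Graph n) (reg : Regular k G) (h : ℕ) (h+n≡3k : h + n ≡ 3 * k) where
  open FinSum n
  open Counting G

  -- K x y c = |(N(x) ∩ N(y)) ∖ N(c)|
  K : Fin n → Fin n → Fin n → ℕ
  K x y c = Σv λ z → α x z * α y z * ᾱ c z

  -- This is (*), sharpened to K. Three neighbourhoods make 3k = h + n incidences on n vertices;
  -- each vertex absorbs one, and the others are charged to overlaps. A vertex in all three is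
  -- charged to the two overlaps with N(c) alone, hence K.
  three-neighbourhoods : ∀ x y c → h ≤ K x y c + codeg y c + codeg x c
  three-neighbourhoods x y c = +-cancelʳ-≤ n _ _ (begin
    h + n                          ≡⟨ h+n≡3k ⟩
    3 * k                          ≡⟨ e k ⟩
    k + k + k                      ≡⟨ cong₂ _+_ (cong₂ _+_ (reg x) (reg y)) (reg c) ⟨
    Σv (α x) + Σv (α y) + Σv (α c) ≡⟨ trans (Σ-+ _ (α c)) (cong (_+ Σv (α c)) (Σ-+ (α x) (α y))) ⟨
    Σv (λ z → α x z + α y z + α c z)
      ≤⟨ Σ-mono (λ z → three-bits (adj G x z) (adj G y z) (adj G c z)) ⟩
    Σv (λ z → 1 + (α x z * α y z * ᾱ c z + α y z * α c z + α x z * α c z))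
      ≡⟨ Σ-+ (λ _ → 1) _ ⟩
    Σv {n} (λ _ → 1) + Σv (λ z → α x z * α y z * ᾱ c z + α y z * α c z + α x z * α c z)
      ≡⟨ cong₂ _+_ (trans (Σ-const 1) (*-identityʳ n)) (trans (Σ-+ _ _) (cong (_+ codeg x c) (Σ-+ _ _))) ⟩
    n + (K x y c + codeg y c + codeg x c) ≡⟨ +-comm n _ ⟩
    K x y c + codeg y c + codeg x c + n   ∎)
    where
    e : ∀ k → 3 * k ≡ k + k + k
    e = solve-∀

  K≤codeg : ∀ x y c → K x y c ≤ codeg x y
  K≤codeg x y c = Σ-mono λ z → ≤-trans (*-monoʳ-≤ (α x z * α y z) (bit≤1 _)) (≤-reflexive (*-identityʳ _))

  -- Triangles (w , y , z) with y ∈ N(c) and z ∉ N(c).  Leaving out z ∈ N(c) costs nothing in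
  -- three-neighbourhoods and gains the factor 3 in 3ΣρSS≤T.
  S : Fin n → Fin n → ℕ
  S w c = Σv λ y → α w y * α c y * K w y c

  Σcodeg≤Tv : ∀ w c → Σv (λ y → α w y * α c y * codeg y c) ≤ Tv c
  Σcodeg≤Tv w c = Σ-mono λ y → *-mono-≤
    (≤-trans (*-monoˡ-≤ (α c y) (bit≤1 (adj G w y))) (≤-reflexive (*-identityˡ (α c y))))
    (≤-reflexive (codeg-sym y c))

  -- Sum `three-neighbourhoods` for w, y, c over the common neighbours y of w and c. The K terms
  -- give S w c; the terms codeg y c belong to edges at c and are paid for by Tv c, which is small
  -- for c = u, v.
  codeg*[h∸codeg]≤S+Tv : ∀ w c → codeg w c * (h ∸ codeg w c) ≤ S w c + Tv c
  codeg*[h∸codeg]≤S+Tv w c = begin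
    codeg w c * (h ∸ codeg w c)                               ≡⟨ Σ-*ʳ (h ∸ codeg w c) _ ⟨
    Σv (λ y → α w y * α c y * (h ∸ codeg w c))             ≤⟨ Σ-mono (λ y → *-monoʳ-≤ (α w y * α c y) (bound y)) ⟩
    Σv (λ y → α w y * α c y * (K w y c + codeg y c))       ≡⟨ Σ-cong (λ y → *-distribˡ-+ (α w y * α c y) _ _) ⟩
    Σv (λ y → α w y * α c y * K w y c + α w y * α c y * codeg y c) ≡⟨ Σ-+ _ _ ⟩
    S w c + Σv (λ y → α w y * α c y * codeg y c)           ≤⟨ +-monoʳ-≤ (S w c) (Σcodeg≤Tv w c) ⟩
    S w c + Tv c                                        ∎
    where
    bound : ∀ y → h ∸ codeg w c ≤ K w y c + codeg y c
    bound y = m≤n+o⇒m∸n≤o h (codeg w c)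
      (≤-trans (three-neighbourhoods w y c) (≤-reflexive (+-comm (K w y c + codeg y c) (codeg w c))))

  S≡Σ² : ∀ w c → S w c ≡ Σv λ y → Σv λ z → α w y * α c y * (α w z * α y z * ᾱ c z)
  S≡Σ² w c = Σ-cong λ y → sym (Σ-*ˡ (α w y * α c y) _)

  -- Two-colourings whose monochromatic pairs have large codegree

  module _ (χ : Fin n → Bool) (odd : ¬ 2 ∣ n)
           (mono : ∀ x y → χ x ≡ χ y → h ≤ 4 * codeg x y) where

    private
      inner : (Fin n → Bool) → ℕ
      inner φ = Σv λ x → Σv λ y → [ φ x ] * ([ φ y ] * α x y)

      cross : (Fin n → Bool) → (Fin n → Bool) → ℕ
      cross φ ψ = Σv λ x → Σv λ y → [ φ x ] * ([ ψ y ] * α x y)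

      size : (Fin n → Bool) → ℕ
      size φ = Σv λ x → [ φ x ]

      χ̄ : Fin n → Bool
      χ̄ = not ∘ χ

      cross-sym : ∀ φ ψ → cross φ ψ ≡ cross ψ φ
      cross-sym φ ψ = trans (Σ-swap λ x y → [ φ x ] * ([ ψ y ] * α x y))
        (Σ-cong λ y → Σ-cong λ x → trans (e [ φ x ] [ ψ y ] (α x y)) (cong (λ ● → [ ψ y ] * ([ φ x ] * ●)) (α-sym x y)))
        where
        e : ∀ a b c → a * (b * c) ≡ b * (a * c)
        e = solve-∀

      degree-sum : ∀ φ ψ → (∀ y → [ φ y ] + [ ψ y ] ≡ 1) → size φ * k ≡ inner φ + cross φ ψ
      degree-sum φ ψ one = begin-equality
        size φ * k                                   ≡⟨ Σ-*ʳ k _ ⟨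
        Σv (λ x → [ φ x ] * k)                       ≡⟨ Σ-cong (λ x → cong ([ φ x ] *_) (reg x)) ⟨
        Σv (λ x → [ φ x ] * Σv (α x))                ≡⟨ Σ-cong (λ x → Σ-*ˡ [ φ x ] (α x)) ⟨
        Σv (λ x → Σv λ y → [ φ x ] * α x y)          ≡⟨ Σ-cong (λ x → Σ-cong λ y → pointwise x y) ⟩
        Σv (λ x → Σv λ y → [ φ x ] * ([ φ y ] * α x y) + [ φ x ] * ([ ψ y ] * α x y)) ≡⟨ Σ²-+ _ _ ⟩
        inner φ + cross φ ψ                          ∎
        where
        e : ∀ p a b c → p * ((a + b) * c) ≡ p * (a * c) + p * (b * c)
        e = solve-∀
        pointwise : ∀ x y → [ φ x ] * α x y ≡ [ φ x ] * ([ φ y ] * α x y) + [ φ x ] * ([ ψ y ] * α x y)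
        pointwise x y = trans
          (cong ([ φ x ] *_) (sym (trans (cong (_* α x y) (one y)) (*-identityˡ (α x y)))))
          (e [ φ x ] [ φ y ] [ ψ y ] (α x y))

      -- The edges between the classes count equally in both degree sums, so the surplus of at least
      -- k on the larger side comes from edges inside it.
      many-inner : ∀ φ ψ → (∀ y → [ φ y ] + [ ψ y ] ≡ 1) → size ψ < size φ → k ≤ inner φ
      many-inner φ ψ one ψ<φ = +-cancelʳ-≤ (size ψ * k) _ _ (begin
        k + size ψ * k            ≤⟨ *-monoˡ-≤ k ψ<φ ⟩
        size φ * k                ≡⟨ degree-sum φ ψ one ⟩
        inner φ + cross φ ψ       ≡⟨ cong (inner φ +_) (cross-sym φ ψ) ⟩
        inner φ + cross ψ φ       ≤⟨ +-monoʳ-≤ (inner φ) (m≤n+m (cross ψ φ) (inner ψ)) ⟩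
        inner φ + (inner ψ + cross ψ φ) ≡⟨ cong (inner φ +_) (degree-sum ψ φ (λ y → trans (+-comm [ ψ y ] _) (one y))) ⟨
        inner φ + size ψ * k      ∎)

      -- T is the sum of codegrees over all ordered edges, and those inside the class contribute at
      -- least h/4 each.
      h*inner≤4T : ∀ φ → (∀ x y → φ x ≡ true → φ y ≡ true → χ x ≡ χ y) → h * inner φ ≤ 4 * T
      h*inner≤4T φ same = begin
        h * inner φ                                            ≡⟨ Σ²-*ˡ h _ ⟨
        Σv (λ x → Σv λ y → h * ([ φ x ] * ([ φ y ] * α x y)))  ≤⟨ Σ-mono (λ x → Σ-mono λ y → pointwise x y) ⟩
        Σv (λ x → Σv λ y → 4 * (α x y * codeg x y))               ≡⟨ Σ²-*ˡ 4 _ ⟩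
        4 * T                                                  ∎
        where
        e : ∀ a b → a * (4 * b) ≡ 4 * (a * b)
        e = solve-∀
        e′ : ∀ h a → h * (1 * (1 * a)) ≡ a * h
        e′ = solve-∀
        pointwise : ∀ x y → h * ([ φ x ] * ([ φ y ] * α x y)) ≤ 4 * (α x y * codeg x y)
        pointwise x y with φ x in φx | φ y in φy
        ... | false | _     = ≤-trans (≤-reflexive (*-zeroʳ h)) z≤n
        ... | true  | false = ≤-trans (≤-reflexive (*-zeroʳ h)) z≤n
        ... | true  | true  = begin
          h * (1 * (1 * α x y))   ≡⟨ e′ h (α x y) ⟩
          α x y * h               ≤⟨ *-monoʳ-≤ (α x y) (mono x y (same x y φx φy)) ⟩
          α x y * (4 * codeg x y)    ≡⟨ e (α x y) (codeg x y) ⟩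
          4 * (α x y * codeg x y)    ∎

      one : ∀ b → [ b ] + [ not b ] ≡ 1
      one true  = refl
      one false = refl

      one̅ : ∀ b → [ not b ] + [ b ] ≡ 1
      one̅ true  = refl
      one̅ false = refl

      not-inj : ∀ a b → not a ≡ true → not b ≡ true → a ≡ b
      not-inj false false _ _ = refl

      size+size : size χ + size χ̄ ≡ n
      size+size = begin-equality
        size χ + size χ̄                       ≡⟨ Σ-+ _ _ ⟨
        Σv (λ x → [ χ x ] + [ not (χ x) ])    ≡⟨ Σ-cong (one ∘ χ) ⟩
        Σv {n} (λ _ → 1)                      ≡⟨ Σ-const 1 ⟩
        n * 1                                 ≡⟨ *-identityʳ n ⟩
        n                                     ∎

    -- Classes of equal size would make n even, so one class is larger and contains k ordered edges.
    partition-bound : h * k ≤ 4 * T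
    partition-bound with <-cmp (size χ̄) (size χ)
    ... | tri< lt _ _ = ≤-trans (*-monoʳ-≤ h (many-inner χ χ̄ (one ∘ χ) lt))
                                (h*inner≤4T χ λ x y p q → trans p (sym q))
    ... | tri> _ _ gt = ≤-trans (*-monoʳ-≤ h (many-inner χ̄ χ (one̅ ∘ χ) gt))
                                (h*inner≤4T χ̄ λ x y → not-inj (χ x) (χ y))
    ... | tri≈ _ eq _ = contradiction (divides (size χ) (trans (sym size+size) (trans (cong (size χ +_) eq) (e (size χ))))) odd
      where
      e : ∀ m → m + m ≡ m * 2
      e = solve-∀

  -- Indicator of the complement of N(u) ∪ N(v). In a blow-up of the 5-cycle with u and v in
  -- adjacent parts, this is the part opposite to them.
  ρ : Fin n → Fin n → Fin n → ℕ
  ρ u v w = ᾱ u w * ᾱ v w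

  -- links u w counts the neighbours of w in N(x) ∩ N(u), and E u v the edges between
  -- N(x) ∩ N(u) and N(x) ∩ N(v).
  module _ (x : Fin n) where

    links : Fin n → Fin n → ℕ
    links u w = Σv λ y → α x y * α u y * α y w

    E : Fin n → Fin n → ℕ
    E u v = Σv λ y → α x y * α u y * links v y

    links-sym : ∀ u w → links u w ≡ Σv λ y → α x y * α u y * α w y
    links-sym u w = Σ-cong λ y → cong (α x y * α u y *_) (α-sym y w)

    links≤codeg : ∀ u w → links u w ≤ codeg x u
    links≤codeg u w = Σ-mono λ y → ≤-trans (*-monoʳ-≤ (α x y * α u y) (bit≤1 _)) (≤-reflexive (*-identityʳ _))

    links≤codeg′ : ∀ u w → links u w ≤ codeg w u
    links≤codeg′ u w = ≤-trans (≤-reflexive (links-sym u w)) (Σ-mono λ y → begin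
      α x y * α u y * α w y     ≡⟨ e (α x y) (α u y) (α w y) ⟩
      α x y * (α w y * α u y)   ≤⟨ *-monoˡ-≤ (α w y * α u y) (bit≤1 (adj G x y)) ⟩
      1 * (α w y * α u y)       ≡⟨ *-identityˡ _ ⟩
      α w y * α u y             ∎)
      where
      e : ∀ a b c → a * b * c ≡ a * (c * b)
      e = solve-∀

    -- Inside N(v), which has k vertices, N(x) and N(y) overlap in `links v y` vertices, so codeg y
    -- v is at most k - codeg x v + `links v y`. The other neighbours of y lie in N(u) or outside
    -- both neighbourhoods.
    outside : ∀ u v y → codeg x v ≤ Σv (λ w → ρ u v w * α y w) + codeg y u + links v y
    outside u v y = +-cancelʳ-≤ k _ _ (begin
      codeg x v + k                              ≡⟨ cong (codeg x v +_) (reg y) ⟨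
      codeg x v + Σv (α y)                       ≤⟨ +-monoʳ-≤ (codeg x v) covered ⟩
      codeg x v + (R + codeg y u + codeg y v)          ≡⟨ e (codeg x v) (R + codeg y u) (codeg y v) ⟩
      R + codeg y u + (codeg y v + codeg x v)          ≤⟨ +-monoʳ-≤ (R + codeg y u) hole ⟩
      R + codeg y u + (links v y + k)            ≡⟨ +-assoc (R + codeg y u) _ k ⟨
      R + codeg y u + links v y + k              ∎)
      where
      R = Σv λ w → ρ u v w * α y w
      e : ∀ a b c → a + (b + c) ≡ b + (c + a)
      e = solve-∀
      covered : Σv (α y) ≤ R + codeg y u + codeg y v
      covered = ≤-trans (Σ-mono λ w → cover-bits (adj G y w) (adj G u w) (adj G v w))
        (≤-reflexive (trans (Σ-+ _ _) (cong (_+ codeg y v) (Σ-+ _ _))))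
      hole : codeg y v + codeg x v ≤ links v y + k
      hole = begin
        codeg y v + codeg x v        ≡⟨ Σ-+ _ _ ⟨
        Σv (λ z → α y z * α v z + α x z * α v z) ≤⟨ Σ-mono (λ z → hole-bits (adj G y z) (adj G v z) (adj G x z)) ⟩
        Σv (λ z → α x z * α v z * α y z + α v z) ≡⟨ Σ-+ _ (α v) ⟩
        Σv (λ z → α x z * α v z * α y z) + Σv (α v) ≡⟨ cong₂ _+_ (sym (links-sym v y)) (reg v) ⟩
        links v y + k          ∎

    -- Sum `outside` over y in P = N(x) ∩ N(u). These y are adjacent to u, so their codegrees with u
    -- total at most Tv u; the main term counts the edges from P to the outside from their other
    -- ends.
    links-outside : ∀ u v → codeg x u * codeg x v ≤ Σv (λ w → ρ u v w * links u w) + (Tv u + E u v)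
    links-outside u v = begin
      codeg x u * codeg x v                   ≡⟨ Σ-*ʳ (codeg x v) _ ⟨
      Σv (λ y → P y * codeg x v)           ≤⟨ Σ-mono (λ y → *-monoʳ-≤ (P y) (outside u v y)) ⟩
      Σv (λ y → P y * (R y + codeg y u + links v y)) ≡⟨ Σ-cong (λ y → e (P y) (R y) (codeg y u) (links v y)) ⟩
      Σv (λ y → P y * R y + (P y * codeg y u + P y * links v y)) ≡⟨ trans (Σ-+ _ _) (cong (Σv (λ y → P y * R y) +_) (Σ-+ _ _)) ⟩
      Σv (λ y → P y * R y) + (Σv (λ y → P y * codeg y u) + E u v)
        ≤⟨ +-mono-≤ (≤-reflexive exchange) (+-monoˡ-≤ (E u v) (Σcodeg≤Tv x u)) ⟩
      Σv (λ w → ρ u v w * links u w) + (Tv u + E u v) ∎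
      where
      P : Fin n → ℕ
      P y = α x y * α u y
      R : Fin n → ℕ
      R y = Σv λ w → ρ u v w * α y w
      e : ∀ p a b c → p * (a + b + c) ≡ p * a + (p * b + p * c)
      e = solve-∀
      e′ : ∀ p a b → p * (a * b) ≡ a * (p * b)
      e′ = solve-∀
      exchange : Σv (λ y → P y * R y) ≡ Σv (λ w → ρ u v w * links u w)
      exchange = begin-equality
        Σv (λ y → P y * R y)                          ≡⟨ Σ-cong (λ y → Σ-*ˡ (P y) _) ⟨
        Σv (λ y → Σv λ w → P y * (ρ u v w * α y w))   ≡⟨ Σ-swap (λ y w → P y * (ρ u v w * α y w)) ⟩
        Σv (λ w → Σv λ y → P y * (ρ u v w * α y w))   ≡⟨ Σ-cong (λ w → Σ-cong λ y → e′ (P y) (ρ u v w) (α y w)) ⟩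
        Σv (λ w → Σv λ y → ρ u v w * (P y * α y w))   ≡⟨ Σ-cong (λ w → Σ-*ˡ (ρ u v w) _) ⟩
        Σv (λ w → ρ u v w * links u w)                ∎

    -- An edge yz between P and Q closes a triangle with x, and disjointness puts z outside N(u), so
    -- S x u counts it.
    E≤S : ∀ u v → (∀ z → adj G u z ∧ adj G v z ≡ false) → E u v ≤ S x u
    E≤S u v disjoint = Σ-mono λ y → *-monoʳ-≤ (α x y * α u y) (Σ-mono λ z → begin
      α x z * α v z * α z y     ≡⟨ cong (α x z * α v z *_) (α-sym z y) ⟩
      α x z * α v z * α y z     ≡⟨ e (α x z) (α v z) (α y z) ⟩
      α x z * α y z * α v z     ≤⟨ *-monoʳ-≤ (α x z * α y z) (disjoint-bits (adj G u z) (adj G v z) (disjoint z)) ⟩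
      α x z * α y z * ᾱ u z     ∎)
      where
      e : ∀ a b c → a * b * c ≡ a * c * b
      e = solve-∀

-- Two vertices with disjoint neighbourhoods

module Light {n k : ℕ} (G : Graph n) (reg : Regular k G) (h : ℕ) (h+n≡3k : h + n ≡ 3 * k)
             (u v : Fin n) (disjoint : ∀ z → adj G u z ∧ adj G v z ≡ false) where
  open FinSum n
  open Counting G
  open Structure G reg h h+n≡3k

  r τ : ℕ
  r = Σv (ρ u v)
  τ = Tv u + Tv v

  r+2k≡n : r + (k + k) ≡ n
  r+2k≡n = begin-equality
    r + (k + k)                              ≡⟨ cong (r +_) (cong₂ _+_ (reg u) (reg v)) ⟨
    r + (Σv (α u) + Σv (α v))                ≡⟨ trans (Σ-+ (ρ u v) _) (cong (r +_) (Σ-+ (α u) (α v))) ⟨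
    Σv (λ w → ρ u v w + (α u w + α v w))     ≡⟨ Σ-cong (λ w → split-bits (adj G u w) (adj G v w) (disjoint w)) ⟩
    Σv {n} (λ _ → 1)                         ≡⟨ Σ-const 1 ⟩
    n * 1                                    ≡⟨ *-identityʳ n ⟩
    n                                        ∎

  codeg+codeg≤k : ∀ w → codeg w u + codeg w v ≤ k
  codeg+codeg≤k w = begin
    codeg w u + codeg w v                              ≡⟨ Σ-+ _ _ ⟨
    Σv (λ z → α w z * α u z + α w z * α v z)     ≤⟨ Σ-mono (λ z → share-bits (adj G w z) (adj G u z) (adj G v z) (disjoint z)) ⟩
    Σv (α w)                                     ≡⟨ reg w ⟩
    k                                            ∎

  SS : Fin n → ℕ
  SS w = S w u + S w v

  private
    -- Selects the ordered triangles that `SS` counts at a first vertex outside both neighbourhoods.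
    -- It is kept apart from `t`, which is invariant under rotation, so that only the selectors need
    -- to be added up.
    c : Fin n → Fin n → Fin n → ℕ
    c x y z = ρ u v x * (α u y * ᾱ u z + α v y * ᾱ v z)

    F : Fin n → Fin n → Fin n → ℕ
    F x y z = t x y z * c x y z

    ρSS≡ΣF : ∀ w → ρ u v w * SS w ≡ Σv λ y → Σv λ z → F w y z
    ρSS≡ΣF w = begin-equality
      ρ u v w * (S w u + S w v)
        ≡⟨ cong (ρ u v w *_) (trans (cong₂ _+_ (S≡Σ² w u) (S≡Σ² w v)) (sym (Σ²-+ _ _))) ⟩
      ρ u v w * Σv (λ y → Σv λ z → α w y * α u y * (α w z * α y z * ᾱ u z) + α w y * α v y * (α w z * α y z * ᾱ v z))
        ≡⟨ Σ²-*ˡ (ρ u v w) _ ⟨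
      Σv (λ y → Σv λ z → ρ u v w * (α w y * α u y * (α w z * α y z * ᾱ u z) + α w y * α v y * (α w z * α y z * ᾱ v z)))
        ≡⟨ Σ-cong (λ y → Σ-cong λ z → e (ρ u v w) (α w y) (α u y) (α w z) (α y z) (ᾱ u z) (α v y) (ᾱ v z)) ⟩
      Σv (λ y → Σv λ z → F w y z) ∎
      where
      e : ∀ ρ wy uy wz yz uz vy vz → ρ * (wy * uy * (wz * yz * uz) + wy * vy * (wz * yz * vz)) ≡
          wy * (wz * yz) * (ρ * (uy * uz + vy * vz))
      e = solve-∀

    t-rotate : ∀ x y z → t y z x ≡ t x y z
    t-rotate x y z = trans (cong₂ (λ a b → α y z * (a * b)) (α-sym y x) (α-sym z x)) (e (α y z) (α x y) (α x z))
      where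
      e : ∀ a b c → a * (b * c) ≡ b * (c * a)
      e = solve-∀

    F-rotations : ∀ x y z → F x y z + F y z x + F z x y ≤ t x y z
    F-rotations x y z = begin
      F x y z + F y z x + F z x y
        ≡⟨ cong₂ (λ a b → F x y z + a * c y z x + b * c z x y) (t-rotate x y z) (sym (t-rotate z x y)) ⟩
      t x y z * c x y z + t x y z * c y z x + t x y z * c z x y
        ≡⟨ e (t x y z) (c x y z) (c y z x) (c z x y) ⟩
      t x y z * (c x y z + c y z x + c z x y)
        ≤⟨ *-monoʳ-≤ (t x y z) (rotation-bits (adj G u x) (adj G v x) (adj G u y) (adj G v y) (adj G u z) (adj G v z)
             (disjoint x) (disjoint y) (disjoint z)) ⟩
      t x y z * 1 ≡⟨ *-identityʳ _ ⟩
      t x y z ∎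
      where
      e : ∀ t a b c → t * a + t * b + t * c ≡ t * (a + b + c)
      e = solve-∀

  -- At most one rotation of a triangle is counted on the left.
  3ΣρSS≤T : 3 * Σv (λ w → ρ u v w * SS w) ≤ T
  3ΣρSS≤T = begin
    3 * Σv (λ w → ρ u v w * SS w)              ≡⟨ cong (3 *_) (Σ-cong ρSS≡ΣF) ⟩
    3 * Σ³ F                                   ≡⟨ e (Σ³ F) ⟩
    Σ³ F + Σ³ F + Σ³ F                         ≡⟨ cong₂ (λ a b → Σ³ F + a + b) (sym (Σ-rotate F)) (Σ-rotate F₂) ⟩
    Σ³ F + Σ³ F₁ + Σ³ F₂                       ≡⟨ trans (Σ³-+ _ F₂) (cong (_+ Σ³ F₂) (Σ³-+ F F₁)) ⟨
    Σ³ (λ x y z → F x y z + F₁ x y z + F₂ x y z) ≤⟨ Σ³-mono F-rotations ⟩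
    Σ³ t                                       ≡⟨ T≡Σ³t ⟨
    T                                          ∎
    where
    Σ³ : (Fin n → Fin n → Fin n → ℕ) → ℕ
    Σ³ f = Σv λ x → Σv λ y → Σv λ z → f x y z
    F₁ F₂ : Fin n → Fin n → Fin n → ℕ
    F₁ x y z = F y z x
    F₂ x y z = F z x y
    e : ∀ m → 3 * m ≡ m + m + m
    e = solve-∀

  -- A lower bound for `SS w` up to the error τ, depending only on the two codegrees of w.
  g : Fin n → ℕ
  g w = codeg w u * (h ∸ codeg w u) + codeg w v * (h ∸ codeg w v)

  g≤SS+τ : ∀ w → g w ≤ SS w + τ
  g≤SS+τ w = ≤-trans (+-mono-≤ (codeg*[h∸codeg]≤S+Tv w u) (codeg*[h∸codeg]≤S+Tv w v))
                     (≤-reflexive (e (S w u) (Tv u) (S w v) (Tv v)))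
    where
    e : ∀ a b c d → a + b + (c + d) ≡ a + c + (b + d)
    e = solve-∀

  3Σρg≤T+3rτ : 3 * Σv (λ w → ρ u v w * g w) ≤ T + 3 * (r * τ)
  3Σρg≤T+3rτ = begin
    3 * Σv (λ w → ρ u v w * g w)
      ≤⟨ *-monoʳ-≤ 3 (Σ-mono λ w → *-monoʳ-≤ (ρ u v w) (g≤SS+τ w)) ⟩
    3 * Σv (λ w → ρ u v w * (SS w + τ))
      ≡⟨ cong (3 *_) (trans (Σ-cong λ w → *-distribˡ-+ (ρ u v w) (SS w) τ) (trans (Σ-+ _ _) (cong (Σv (λ w → ρ u v w * SS w) +_) (Σ-*ʳ τ (ρ u v))))) ⟩
    3 * (Σv (λ w → ρ u v w * SS w) + r * τ)
      ≡⟨ *-distribˡ-+ 3 (Σv λ w → ρ u v w * SS w) (r * τ) ⟩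
    3 * Σv (λ w → ρ u v w * SS w) + 3 * (r * τ)
      ≤⟨ +-monoˡ-≤ (3 * (r * τ)) 3ΣρSS≤T ⟩
    T + 3 * (r * τ) ∎

  k≡h+r : k ≡ h + r
  k≡h+r = +-cancelʳ-≡ (k + k) _ _ (begin-equality
    k + (k + k)        ≡⟨ e k ⟩
    3 * k              ≡⟨ h+n≡3k ⟨
    h + n              ≡⟨ cong (h +_) r+2k≡n ⟨
    h + (r + (k + k))  ≡⟨ +-assoc h r _ ⟨
    h + r + (k + k)    ∎)
    where
    e : ∀ k → k + (k + k) ≡ 3 * k
    e = solve-∀

  module _ (r+2≤h : r + 2 ≤ h) (2T≤h² : 2 * T ≤ h * h) (4τ<h : 4 * τ < h) where

    private
      2≤h : 2 ≤ h
      2≤h = ≤-trans (m≤n+m 2 r) r+2≤h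

      instance
        h≢0 : NonZero h
        h≢0 = >-nonZero (≤-trans (s≤s z≤n) 2≤h)

    -- An edge between c and x would contribute codeg x c to Tv c ≤ τ < h/4, less than the assumed
    -- 3h/8.
    far : ∀ x c → Tv c ≤ τ → 3 * h < 8 * codeg x c → adj G c x ≡ false
    far x c Tc≤τ big with adj G c x in cx
    ... | false = refl
    ... | true  = contradiction big (≤⇒≯ (begin
      8 * codeg x c                ≡⟨ cong (8 *_) (trans (codeg-sym x c) (sym (*-identityˡ (codeg c x)))) ⟩
      8 * (1 * codeg c x)          ≡⟨ cong (λ b → 8 * ([ b ] * codeg c x)) cx ⟨
      8 * (α c x * codeg c x)      ≤⟨ *-monoʳ-≤ 8 (≤-trans (term≤Σ (λ y → α c y * codeg c y) x) Tc≤τ) ⟩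
      8 * τ                     ≡⟨ *-assoc 2 4 τ ⟩
      2 * (4 * τ)               ≤⟨ *-monoʳ-≤ 2 (<⇒≤ 4τ<h) ⟩
      2 * h                     ≤⟨ *-monoˡ-≤ h (s≤s (s≤s (z≤n {1}))) ⟩
      3 * h                     ∎))

    -- Excludes Case 2. By `far`, x lies outside both neighbourhoods, so SS x ≤ T/3 ≤ h²/6. With 24τ
    -- ≤ h² this bounds SS x + τ, and with it both g x and A + B, by the 5h²/24 of the arithmetic
    -- lemmas.
    no-spread-vertex : ∀ x → 3 * h < 8 * codeg x u → ¬ 3 * h < 8 * codeg x v
    no-spread-vertex x big-u big-v = no-dense-blowup h r p q T τ A B Π Γ r+2≤h
      (subst (p + q ≤_) k≡h+r (codeg+codeg≤k x)) 2T≤h² (<⇒≤ 4τ<h) 5h≤8p 5h≤8q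
      (large-sum h p q 5h≤8p 5h≤8q (≤-trans (*-monoʳ-≤ 24 (g≤SS+τ x)) small))
      (≤-trans (*-monoʳ-≤ 24 A+B≤) small) Π-lower Γ-lower 3Σρg≤T+3rτ
      where
      p = codeg x u
      q = codeg x v
      i j : Fin n → ℕ
      i = links x u
      j = links x v
      -- B and A are the errors of `links-outside` counted from P and from Q. Π counts the paths
      -- from P to Q through a vertex outside both neighbourhoods.
      A = Tv v + E x v u
      B = Tv u + E x u v
      Π = Σv λ w → ρ u v w * (i w * j w)
      Γ = Σv λ w → ρ u v w * g w

      ρx≡1 : ρ u v x ≡ 1
      ρx≡1 = cong₂ (λ a b → [ not a ] * [ not b ])
        (far x u (m≤m+n (Tv u) (Tv v)) big-u) (far x v (m≤n+m (Tv v) (Tv u)) big-v)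

      3SS≤T : 3 * SS x ≤ T
      3SS≤T = ≤-trans (*-monoʳ-≤ 3 (≤-trans
        (≤-reflexive (sym (trans (cong (_* SS x) ρx≡1) (*-identityˡ (SS x)))))
        (term≤Σ (λ w → ρ u v w * SS w) x))) 3ΣρSS≤T

      small : 24 * (SS x + τ) ≤ 5 * (h * h)
      small = begin
        24 * (SS x + τ)                  ≡⟨ e (SS x) τ ⟩
        4 * (2 * (3 * SS x)) + 24 * τ    ≤⟨ +-mono-≤ (*-monoʳ-≤ 4 (≤-trans (*-monoʳ-≤ 2 3SS≤T) 2T≤h²)) (24τ≤h² τ h 4τ<h) ⟩
        4 * (h * h) + h * h              ≡⟨ +-comm (4 * (h * h)) (h * h) ⟩
        5 * (h * h)                      ∎
        where
        e : ∀ s τ → 24 * (s + τ) ≡ 4 * (2 * (3 * s)) + 24 * τ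
        e = solve-∀

      5h≤8p : 5 * h ≤ 8 * p
      5h≤8p = past-middle h p big-u
        (≤-trans (*-monoʳ-≤ 24 (≤-trans (m≤m+n (p * (h ∸ p)) (q * (h ∸ q))) (g≤SS+τ x))) small)

      5h≤8q : 5 * h ≤ 8 * q
      5h≤8q = past-middle h q big-v
        (≤-trans (*-monoʳ-≤ 24 (≤-trans (m≤n+m (q * (h ∸ q)) (p * (h ∸ p))) (g≤SS+τ x))) small)

      A+B≤ : A + B ≤ SS x + τ
      A+B≤ = begin
        Tv v + E x v u + (Tv u + E x u v)
          ≤⟨ +-mono-≤ (+-monoʳ-≤ (Tv v) (E≤S x v u (λ z → trans (∧-comm (adj G v z) _) (disjoint z))))
                      (+-monoʳ-≤ (Tv u) (E≤S x u v disjoint)) ⟩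
        Tv v + S x v + (Tv u + S x u)       ≡⟨ e (Tv v) (S x v) (Tv u) (S x u) ⟩
        SS x + τ                            ∎
        where
        e : ∀ a b c d → a + b + (c + d) ≡ d + b + (c + a)
        e = solve-∀

      pq≤I+B : p * q ≤ Σv (λ w → ρ u v w * i w) + B
      pq≤I+B = links-outside x u v

      pq≤J+A : p * q ≤ Σv (λ w → ρ u v w * j w) + A
      pq≤J+A = ≤-trans (≤-reflexive (*-comm p q)) (≤-trans (links-outside x v u)
        (≤-reflexive (cong (_+ A) (Σ-cong λ w → cong (_* j w) (*-comm (ᾱ v w) (ᾱ u w))))))

      -- Summing `cross≤` over the r outside vertices: the links from P and those from Q are so many
      -- that they must often meet in the same w.
      Π-lower : p * q * (p + q) ≤ Π + r * (p * q) + (p * A + q * B)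
      Π-lower = begin
        p * q * (p + q)                          ≡⟨ e₁ p q ⟩
        p * (p * q) + q * (p * q)                ≤⟨ +-mono-≤ (*-monoʳ-≤ p pq≤J+A) (*-monoʳ-≤ q pq≤I+B) ⟩
        p * (J + A) + q * (I + B)                ≡⟨ e₂ p q J A I B ⟩
        p * J + q * I + (p * A + q * B)          ≤⟨ +-monoˡ-≤ (p * A + q * B) crossed ⟩
        Π + r * (p * q) + (p * A + q * B)        ∎
        where
        I = Σv λ w → ρ u v w * i w
        J = Σv λ w → ρ u v w * j w
        e₁ : ∀ p q → p * q * (p + q) ≡ p * (p * q) + q * (p * q)
        e₁ = solve-∀
        e₂ : ∀ p q J A I B → p * (J + A) + q * (I + B) ≡ p * J + q * I + (p * A + q * B)
        e₂ = solve-∀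
        e₃ : ∀ p q ρ i j → p * (ρ * j) + q * (ρ * i) ≡ ρ * (p * j + q * i)
        e₃ = solve-∀
        crossed : p * J + q * I ≤ Π + r * (p * q)
        crossed = begin
          p * J + q * I                                                ≡⟨ cong₂ _+_ (Σ-*ˡ p _) (Σ-*ˡ q _) ⟨
          Σv (λ w → p * (ρ u v w * j w)) + Σv (λ w → q * (ρ u v w * i w)) ≡⟨ Σ-+ _ _ ⟨
          Σv (λ w → p * (ρ u v w * j w) + q * (ρ u v w * i w))         ≡⟨ Σ-cong (λ w → e₃ p q (ρ u v w) (i w) (j w)) ⟩
          Σv (λ w → ρ u v w * (p * j w + q * i w))
            ≤⟨ Σ-mono (λ w → *-monoʳ-≤ (ρ u v w) (cross≤ (links≤codeg x u w) (links≤codeg x v w))) ⟩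
          Σv (λ w → ρ u v w * (i w * j w + p * q))                     ≡⟨ Σ-cong (λ w → *-distribˡ-+ (ρ u v w) (i w * j w) (p * q)) ⟩
          Σv (λ w → ρ u v w * (i w * j w) + ρ u v w * (p * q))         ≡⟨ trans (Σ-+ _ _) (cong (Π +_) (Σ-*ʳ (p * q) (ρ u v))) ⟩
          Π + r * (p * q)                                              ∎

      -- Because h ≥ 2, the hypothesis gives 8m ≥ 10.
      at-least-2 : ∀ m → 5 * h ≤ 8 * m → 2 ≤ m
      at-least-2 zero          le = contradiction (≤-trans (*-monoʳ-≤ 5 2≤h) le) λ ()
      at-least-2 (suc zero)    le = contradiction (≤-trans (*-monoʳ-≤ 5 2≤h) le) λ { (s≤s (s≤s (s≤s (s≤s (s≤s (s≤s (s≤s (s≤s ())))))))) }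
      at-least-2 (suc (suc m)) le = s≤s (s≤s z≤n)

      codeg+codeg+2≤2h : ∀ w → codeg w u + codeg w v + 2 ≤ 2 * h
      codeg+codeg+2≤2h w = begin
        codeg w u + codeg w v + 2    ≤⟨ +-monoˡ-≤ 2 (≤-trans (codeg+codeg≤k w) (≤-reflexive k≡h+r)) ⟩
        h + r + 2              ≡⟨ +-assoc h r 2 ⟩
        h + (r + 2)            ≤⟨ +-monoʳ-≤ h r+2≤h ⟩
        h + h                  ≡⟨ cong (h +_) (+-identityʳ h) ⟨
        2 * h                  ∎

      -- `weighted-two-sided` at each outside w, whose links to P and Q are bounded both by p, q and
      -- by its codegrees with u, v.
      Γ-lower : 2 * (h ∸ 2) * Π ≤ p * q * Γ
      Γ-lower = begin
        2 * (h ∸ 2) * Π                                      ≡⟨ Σ-*ˡ (2 * (h ∸ 2)) _ ⟨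
        Σv (λ w → 2 * (h ∸ 2) * (ρ u v w * (i w * j w)))     ≡⟨ Σ-cong (λ w → e (2 * (h ∸ 2)) (ρ u v w) (i w * j w)) ⟩
        Σv (λ w → ρ u v w * (2 * (h ∸ 2) * (i w * j w)))
          ≤⟨ Σ-mono (λ w → *-monoʳ-≤ (ρ u v w) (weighted-two-sided (codeg w u) (codeg w v) h p q (i w) (j w)
               (at-least-2 p 5h≤8p) (at-least-2 q 5h≤8q) (codeg+codeg+2≤2h w)
               (links≤codeg′ x u w) (links≤codeg x u w) (links≤codeg′ x v w) (links≤codeg x v w))) ⟩
        Σv (λ w → ρ u v w * (p * q * g w))                   ≡⟨ Σ-cong (λ w → e (ρ u v w) (p * q) (g w)) ⟩
        Σv (λ w → p * q * (ρ u v w * g w))                   ≡⟨ Σ-*ˡ (p * q) _ ⟩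
        p * q * Γ                                            ∎
        where
        e : ∀ a b c → a * (b * c) ≡ b * (a * c)
        e = solve-∀

    h*k≤4T : ¬ 2 ∣ n → h * k ≤ 4 * T
    h*k≤4T odd = partition-bound χ odd mono
      where
      few? : ∀ x c → Dec (8 * codeg x c ≤ 3 * h)
      few? x c = 8 * codeg x c ≤? 3 * h

      -- Case 1 holds throughout by `no-spread-vertex`: a vertex not coloured `true` for v has small
      -- codegree with u. Vertices with both codegrees small are coloured `true`.
      χ : Fin n → Bool
      χ x = does (few? x v)

      -- By `three-neighbourhoods`, two codegrees of at most 3h/8 with c leave h/4 for codeg x y.
      inner-edge : ∀ x y c → 8 * codeg x c ≤ 3 * h → 8 * codeg y c ≤ 3 * h → h ≤ 4 * codeg x y
      inner-edge x y c xc yc = *-cancelˡ-≤ 2 (+-cancelʳ-≤ (3 * h + 3 * h) _ _ (begin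
        2 * h + (3 * h + 3 * h)                           ≡⟨ e₁ h ⟩
        8 * h                                             ≤⟨ *-monoʳ-≤ 8 (three-neighbourhoods x y c) ⟩
        8 * (K x y c + codeg y c + codeg x c)                   ≤⟨ *-monoʳ-≤ 8 (+-monoˡ-≤ (codeg x c) (+-monoˡ-≤ (codeg y c) (K≤codeg x y c))) ⟩
        8 * (codeg x y + codeg y c + codeg x c)                    ≡⟨ e₂ (codeg x y) (codeg y c) (codeg x c) ⟩
        2 * (4 * codeg x y) + (8 * codeg y c + 8 * codeg x c)      ≤⟨ +-monoʳ-≤ (2 * (4 * codeg x y)) (+-mono-≤ yc xc) ⟩
        2 * (4 * codeg x y) + (3 * h + 3 * h)                ∎))
        where
        e₁ : ∀ h → 2 * h + (3 * h + 3 * h) ≡ 8 * h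
        e₁ = solve-∀
        e₂ : ∀ a b c → 8 * (a + b + c) ≡ 2 * (4 * a) + (8 * b + 8 * c)
        e₂ = solve-∀

      few-u : ∀ x → ¬ 8 * codeg x v ≤ 3 * h → 8 * codeg x u ≤ 3 * h
      few-u x ¬few = ≮⇒≥ λ big → no-spread-vertex x big (≰⇒> ¬few)

      mono : ∀ x y → χ x ≡ χ y → h ≤ 4 * codeg x y
      mono x y = split (few? x v) (few? y v)
        where
        split : (x? : Dec (8 * codeg x v ≤ 3 * h)) (y? : Dec (8 * codeg y v ≤ 3 * h)) →
                does x? ≡ does y? → h ≤ 4 * codeg x y
        split (yes xv) (yes yv) _ = inner-edge x y v xv yv
        split (no ¬xv) (no ¬yv) _ = inner-edge x y u (few-u x ¬xv) (few-u y ¬yv)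

-- Parity and the degree condition

odd⇒2∤ : ∀ n → n % 2 ≡ 1 → ¬ 2 ∣ n
odd⇒2∤ n n-odd (divides m refl) = contradiction (trans (sym n-odd) (m*n%n≡0 m 2)) λ ()

even-cofactor : ∀ n k → n % 2 ≡ 1 → 2 ∣ n * k → 2 ∣ k
even-cofactor n k n-odd 2∣nk = ∣m+n∣m⇒∣n (subst (2 ∣_) n*k≡ 2∣nk) (m∣m*n (n / 2 * k))
  where
  e : ∀ q k → (1 + q * 2) * k ≡ 2 * (q * k) + k
  e = solve-∀
  n*k≡ : n * k ≡ 2 * (n / 2 * k) + k
  n*k≡ = trans (cong (_* k) (trans (m≡m%n+[m/n]*n n 2) (cong (_+ n / 2 * 2) n-odd))) (e (n / 2) k)

-- An even k above 2⌊n/5⌋ is at least 2⌊n/5⌋ + 2, and n ≤ 5⌊n/5⌋ + 4.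
2n+2≤5k : ∀ n k → 2 ∣ k → 2 * (n / 5) < k → 2 * n + 2 ≤ 5 * k
2n+2≤5k n .(c * 2) (divides c refl) lt = begin
  2 * n + 2                          ≡⟨ cong (λ ● → 2 * ● + 2) (m≡m%n+[m/n]*n n 5) ⟩
  2 * (n % 5 + n / 5 * 5) + 2        ≤⟨ +-monoˡ-≤ 2 (*-monoʳ-≤ 2 (+-monoˡ-≤ (n / 5 * 5) (≤-pred (m%n<n n 5)))) ⟩
  2 * (4 + n / 5 * 5) + 2            ≡⟨ e₁ (n / 5) ⟩
  10 * suc (n / 5)                   ≤⟨ *-monoʳ-≤ 10 (*-cancelˡ-< 2 (n / 5) c (subst (2 * (n / 5) <_) (*-comm c 2) lt)) ⟩
  10 * c                             ≡⟨ e₂ c ⟩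
  5 * (c * 2)                        ∎
  where
  e₁ : ∀ q → 2 * (4 + q * 5) + 2 ≡ 10 * (1 + q)
  e₁ = solve-∀
  e₂ : ∀ c → 10 * c ≡ 5 * (c * 2)
  e₂ = solve-∀

-- Contradiction from too few triangles

module Main {n k : ℕ} (G : Graph n) (reg : Regular k G) (n-odd : ¬ 2 ∣ n)
            (dense : 2 * n + 2 ≤ 5 * k) where
  open FinSum n
  open Counting G

  private
    n≤3k : n ≤ 3 * k
    n≤3k = *-cancelˡ-≤ 2 (begin
      2 * n           ≤⟨ ≤-trans (m≤m+n (2 * n) 2) dense ⟩
      5 * k           ≤⟨ *-monoˡ-≤ k (≤ᵇ⇒≤ 5 6 _) ⟩
      6 * k           ≡⟨ *-assoc 2 3 k ⟩
      2 * (3 * k)     ∎)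

    h = 3 * k ∸ n

    h+n≡3k : h + n ≡ 3 * k
    h+n≡3k = m∸n+n≡m n≤3k

    k>0 : 0 < k
    k>0 = n≢0⇒n>0 λ { refl → contradiction (≤-trans (m≤n+m 2 (2 * n)) dense) λ () }

  -- A light edge supplies u and v, and `h*k≤4T` yields 25hk ≤ 100T < 2n². This contradicts h ≥ n/5
  -- and k ≥ 2n/5.
  ¬50T<n² : ¬ 50 * T < n * n
  ¬50T<n² 50T<n² = <⇒≱ 25hk<2n² 2n²≤25hk
    where
    instance
      n≢0 : NonZero n
      n≢0 = ≢-nonZero λ { refl → contradiction 50T<n² λ () }

    edge = light-edge reg (*-mono-≤ (>-nonZero⁻¹ n) k>0)
    u = proj₁ edge
    v = proj₁ (proj₂ edge)
    n*weight≤5T = proj₂ (proj₂ edge)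

    -- The light edge has weight at most 5T/n, below n/10. This is used with m = k to make u and v
    -- have disjoint neighbourhoods, and with m = 2τ to make τ small.
    10m<n : ∀ m → m ≤ weight reg u v → 10 * m < n
    10m<n m m≤w = *-cancelˡ-< n (10 * m) n (begin-strict
      n * (10 * m)                ≡⟨ e n m ⟩
      10 * (n * m)                ≤⟨ *-monoʳ-≤ 10 (≤-trans (*-monoʳ-≤ n m≤w) n*weight≤5T) ⟩
      10 * (5 * T)                ≡⟨ *-assoc 10 5 T ⟨
      50 * T                      <⟨ 50T<n² ⟩
      n * n                       ∎)
      where
      e : ∀ n m → n * (10 * m) ≡ 10 * (n * m)
      e = solve-∀

    -- A positive codegree would bring the weight to at least k, forcing 10k < n against the
    -- density.
    codeg≡0 : codeg u v ≡ 0
    codeg≡0 with codeg u v in eq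
    ... | zero  = refl
    ... | suc c = contradiction (10m<n k k≤weight) (≤⇒≯ (begin
      n              ≤⟨ m≤n*m n 2 ⟩
      2 * n          ≤⟨ ≤-trans (m≤m+n (2 * n) 2) dense ⟩
      5 * k          ≤⟨ *-monoˡ-≤ k (≤ᵇ⇒≤ 5 10 _) ⟩
      10 * k         ∎))
      where
      k≤weight : k ≤ weight reg u v
      k≤weight = ≤-trans (subst (λ ● → k ≤ k * ●) (sym eq) (m≤m*n k (suc c))) (m≤n+m _ _)

    disjoint : ∀ z → adj G u z ∧ adj G v z ≡ false
    disjoint z = []-∧ (adj G u z) (adj G v z) (n≤0⇒n≡0 (subst (α u z * α v z ≤_) codeg≡0 (term≤Σ (λ z → α u z * α v z) z)))

    open Light G reg h h+n≡3k u v disjoint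

    n≡2h+3r : n ≡ 2 * h + 3 * r
    n≡2h+3r = trans (sym r+2k≡n) (trans (cong (λ k → r + (k + k)) k≡h+r) (e h r))
      where
      e : ∀ h r → r + (h + r + (h + r)) ≡ 2 * h + 3 * r
      e = solve-∀

    -- The density 2n + 2 ≤ 5k rewritten through n = 2h + 3r and k = h + r; the 2 gained from the
    -- parity of k survives.
    r+2≤h : r + 2 ≤ h
    r+2≤h = +-cancelˡ-≤ (4 * h + 5 * r) _ _ (begin
      4 * h + 5 * r + (r + 2)       ≡⟨ e₁ h r ⟩
      2 * (2 * h + 3 * r) + 2       ≡⟨ cong (λ ● → 2 * ● + 2) n≡2h+3r ⟨
      2 * n + 2                     ≤⟨ dense ⟩
      5 * k                         ≡⟨ cong (5 *_) k≡h+r ⟩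
      5 * (h + r)                   ≡⟨ e₂ h r ⟩
      4 * h + 5 * r + h             ∎)
      where
      e₁ : ∀ h r → 4 * h + 5 * r + (r + 2) ≡ 2 * (2 * h + 3 * r) + 2
      e₁ = solve-∀
      e₂ : ∀ h r → 5 * (h + r) ≡ 4 * h + 5 * r + h
      e₂ = solve-∀

    r≤h : r ≤ h
    r≤h = ≤-trans (m≤m+n r 2) r+2≤h

    n≤5h : n ≤ 5 * h
    n≤5h = begin
      n                  ≡⟨ n≡2h+3r ⟩
      2 * h + 3 * r      ≤⟨ +-monoʳ-≤ (2 * h) (*-monoʳ-≤ 3 r≤h) ⟩
      2 * h + 3 * h      ≡⟨ *-distribʳ-+ h 2 3 ⟨
      5 * h              ∎

    2T≤h² : 2 * T ≤ h * h
    2T≤h² = *-cancelˡ-≤ 25 (begin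
      25 * (2 * T)       ≡⟨ *-assoc 25 2 T ⟨
      50 * T             ≤⟨ <⇒≤ 50T<n² ⟩
      n * n              ≤⟨ *-mono-≤ n≤5h n≤5h ⟩
      5 * h * (5 * h)    ≡⟨ e h ⟩
      25 * (h * h)       ∎)
      where
      e : ∀ h → 5 * h * (5 * h) ≡ 25 * (h * h)
      e = solve-∀

    4τ<h : 4 * τ < h
    4τ<h = *-cancelˡ-< 5 (4 * τ) h (begin-strict
      5 * (4 * τ)        ≡⟨ e τ ⟩
      10 * (2 * τ)       <⟨ 10m<n (2 * τ) (≤-trans (≤-reflexive (*-distribˡ-+ 2 (Tv u) (Tv v))) (m≤m+n _ _)) ⟩
      n                  ≤⟨ n≤5h ⟩
      5 * h              ∎)
      where
      e : ∀ τ → 5 * (4 * τ) ≡ 10 * (2 * τ)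
      e = solve-∀

    25hk<2n² : 25 * (h * k) < 2 * (n * n)
    25hk<2n² = begin-strict
      25 * (h * k)      ≤⟨ *-monoʳ-≤ 25 (h*k≤4T r+2≤h 2T≤h² 4τ<h n-odd) ⟩
      25 * (4 * T)      ≡⟨ e T ⟩
      2 * (50 * T)      <⟨ *-monoʳ-< 2 50T<n² ⟩
      2 * (n * n)       ∎
      where
      e : ∀ T → 25 * (4 * T) ≡ 2 * (50 * T)
      e = solve-∀

    2n²≤25hk : 2 * (n * n) ≤ 25 * (h * k)
    2n²≤25hk = begin
      2 * (n * n)                                          ≡⟨ cong (λ ● → 2 * (● * ●)) n≡2h+3r ⟩
      2 * ((2 * h + 3 * r) * (2 * h + 3 * r))              ≡⟨ e₁ h r ⟩
      -- The term 18r² is split so that 17r² is bounded by 17h² and the last r² by hr, matching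
      -- 25h(h + r).
      8 * (h * h) + 24 * (h * r) + (17 * (r * r) + r * r)
        ≤⟨ +-monoʳ-≤ (8 * (h * h) + 24 * (h * r)) (+-mono-≤ (*-monoʳ-≤ 17 (*-mono-≤ r≤h r≤h)) (*-monoˡ-≤ r r≤h)) ⟩
      8 * (h * h) + 24 * (h * r) + (17 * (h * h) + h * r)  ≡⟨ e₂ h r ⟩
      25 * (h * (h + r))                                   ≡⟨ cong (λ ● → 25 * (h * ●)) k≡h+r ⟨
      25 * (h * k)                                         ∎
      where
      e₁ : ∀ h r → 2 * ((2 * h + 3 * r) * (2 * h + 3 * r)) ≡ 8 * (h * h) + 24 * (h * r) + (17 * (r * r) + r * r)
      e₁ = solve-∀
      e₂ : ∀ h r → 8 * (h * h) + 24 * (h * r) + (17 * (h * h) + h * r) ≡ 25 * (h * (h + r))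
      e₂ = solve-∀

theorem2 : (n k : ℕ) (G : Graph n) → Regular k G → n % 2 ≡ 1 →
    2 * (n / 5) < k → n * n ≤ 300 * triangles G
theorem2 n k G reg n-odd k-large = begin
  -- The constant is 300 = 50 · 6, as `T` counts ordered triangles.
  n * n                      ≤⟨ ≮⇒≥ ¬50T<n² ⟩
  50 * T                     ≤⟨ *-monoʳ-≤ 50 T≤6triangles ⟩
  50 * (6 * triangles G)     ≡⟨ *-assoc 50 6 (triangles G) ⟨
  300 * triangles G          ∎
  where
  open Counting G
  open Main G reg (odd⇒2∤ n n-odd) (2n+2≤5k n k (even-cofactor n k n-odd (nk-even reg)) k-large)
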